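{- Let $G$ be the $n\times n$ real matrix with entries $G_{ij}=\frac1p\,\sigma^{\,i+j}(x)$ for $0\le i,j\le n-1$ (exponents of $\sigma$ may be read modulo $n$, since $\sigma^n(x)=x$). Then $G$ is orthogonal: $GG^T=G^TG=I_n$.
   Context: Let $n>1$ be an odd integer and $p$ a prime with $p\equiv 1 \pmod n$. Let $\zeta_p=e^{2\pi i/p}$, let $r$ be a primitive root modulo $p$, and let $\sigma$ be the automorphism of $\mathbb{Q}(\zeta_p)$ with $\sigma(\zeta_p)=\zeta_p^r$. Let $\mathbb{K}=\{y\in\mathbb{Q}(\zeta_p):\sigma^n(y)=y\}$; it is a totally real field of degree $n$, contained in $\mathbb{R}$ via $\mathbb{Q}(\zeta_p)\subset\mathbb{C}$, and its embeddings into $\mathbb{R}$ are the restrictions of $\sigma^0,\dots,\sigma^{n-1}$. Let $\alpha=\prod_{j=0}^{(p-3)/2}(1-\zeta_p^{r^j})$, let $\lambda$ be an integer with $\lambda(r-1)\equiv1\pmod p$, let $z=\zeta_p^{\lambda}\alpha(1-\zeta_p)$, and let $x=\mathrm{Tr}_{\mathbb{Q}(\zeta_p)/\mathbb{K}}(z)=\sum_{j=1}^{(p-1)/n}\sigma^{jn}(z)\in\mathcal{O}_\mathbb{K}$. -}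

module Defs where

open import Algebra.Apartness.Bundles using (HeytingField)
open import Algebra.Bundles using (CommutativeRing; RawRing)
open import Algebra.Core using (Op₁; Op₂)
open import Algebra.Morphism.Structures using (module RingMorphisms)
import Algebra.Consequences.Setoid as Consequences
import Algebra.Construct.DirectProduct as DirectProduct
import Algebra.Definitions.RawSemiring as RawSemiringDefs
import Algebra.Morphism.RingMonomorphism as RingMonomorphism
import Algebra.Properties.Ring as RingProperties
import Algebra.Solver.Ring.NaturalCoefficients.Default as Solver
open import Data.Bool.Base using (if_then_else_)
open import Data.Fin.Base using (Fin; toℕ)
import Data.Fin.Properties as Fin
open import Data.Integer.Base as ℤ using (ℤ; +_; -[1+_])
import Data.Integer.Coprimality as ℤ
import Data.Integer.Divisibility as ℤ
open import Data.Nat.Base as ℕ using (ℕ; zero; suc; NonZero; _∸_; _/_)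
open import Data.Product.Base using (Σ; ∃-syntax; _×_; _,_; proj₁)
open import Data.Sum.Base using (_⊎_)
import Function.Endo.Propositional as Endo
open import Level using (_⊔_) renaming (suc to lsuc)
open import Relation.Binary.Core using (Rel)
open import Relation.Binary.Structures using (IsStrictPartialOrder)
open import Relation.Nullary.Decidable.Core using (does)
import Relation.Binary.Reasoning.Setoid as ≈-Reasoning

infix 4 _≡_[mod_]

_≡_[mod_] : ℤ → ℤ → ℕ → Set
a ≡ b [mod m ] = + m ℤ.∣ a ℤ.- b

IsPrimitiveRoot : ℤ → ℕ → Set
IsPrimitiveRoot r m =
  ℤ.Coprime r (+ m) ×
  (∀ a → ℤ.Coprime a (+ m) → ∃[ k ] r ℤ.^ k ≡ a [mod m ])

-- The real numbers, axiomatised as a Cauchy-complete Archimedean ordered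
-- field.  Classically these axioms determine ℝ up to unique isomorphism.
-- The order is strict and not assumed decidable, and inequality is the
-- apartness  x < y ⊎ y < x,  so that the usual constructive real numbers
-- satisfy the axioms as well.
record RealField c ℓ₁ ℓ₂ : Set (lsuc (c ⊔ ℓ₁ ⊔ ℓ₂)) where
  infix 4 _<_
  field
    heytingField : HeytingField c ℓ₁ ℓ₂

  open HeytingField heytingField public

  commutativeRing : CommutativeRing c ℓ₁
  commutativeRing = record { isCommutativeRing = isCommutativeRing }

  open CommutativeRing commutativeRing public using (rawRing)
  open RawRing rawRing public using (rawSemiring)

  open RawSemiringDefs rawSemiring using () renaming (_×_ to _×ℕ_)

  fromℕ : ℕ → Carrier
  fromℕ k = k ×ℕ 1#

  field
    _<_                  : Rel Carrier ℓ₂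
    isStrictPartialOrder : IsStrictPartialOrder _≈_ _<_
    #⇒<⊎>                : ∀ {x y} → x # y → x < y ⊎ y < x
    <⇒#                  : ∀ {x y} → x < y → x # y
    0<1                  : 0# < 1#
    +-monoʳ-<            : ∀ z {x y} → x < y → z + x < z + y
    *-pos                : ∀ {x y} → 0# < x → 0# < y → 0# < x * y
    archimedean          : ∀ x → ∃[ k ] x < fromℕ k

  open IsStrictPartialOrder isStrictPartialOrder public
    using (<-resp-≈; <-respˡ-≈; <-respʳ-≈)
    renaming (irrefl to <-irrefl; trans to <-trans)

  -- The bound on s i - s j is required for both orders of the indices,
  -- hence bounds its absolute value.
  IsCauchy : (ℕ → Carrier) → Set (c ⊔ ℓ₂)
  IsCauchy s = ∀ ε → 0# < ε →
    ∃[ N ] ∀ i j → N ℕ.≤ i → N ℕ.≤ j → s i - s j < ε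

  ConvergesTo : (ℕ → Carrier) → Carrier → Set (c ⊔ ℓ₂)
  ConvergesTo s l = ∀ ε → 0# < ε →
    ∃[ N ] ∀ i → N ℕ.≤ i → s i - l < ε × l - s i < ε

  field
    complete : ∀ s → IsCauchy s → ∃[ l ] ConvergesTo s l

  fromℕ-pos : ∀ k → 0# < fromℕ (suc k)
  fromℕ-pos zero    = <-respʳ-≈ (sym (+-identityʳ 1#)) 0<1
  fromℕ-pos (suc k) =
    <-trans 0<1 (<-respˡ-≈ (+-identityʳ 1#) (+-monoʳ-< 1# (fromℕ-pos k)))

  -- #⇒invertible inverts fromℕ k - 0#, which is equal to fromℕ k.
  1/ℕ : ∀ k .{{_ : NonZero k}} → Carrier
  1/ℕ (suc k) = proj₁ (#⇒invertible (#-sym (<⇒# (fromℕ-pos k))))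

Matrix : ∀ {a} → Set a → ℕ → Set a
Matrix A n = Fin n → Fin n → A

module MatrixOps {a ℓ} (R : RawRing a ℓ) where
  open RawRing R
  open RawSemiringDefs rawSemiring using (sum)

  infixl 7 _*ᴹ_
  infix  4 _≈ᴹ_

  _≈ᴹ_ : ∀ {n} → Rel (Matrix Carrier n) ℓ
  A ≈ᴹ B = ∀ i j → A i j ≈ B i j

  _*ᴹ_ : ∀ {n} → Op₂ (Matrix Carrier n)
  (A *ᴹ B) i k = sum (λ j → A i j * B j k)

  _ᵀ : ∀ {n} → Op₁ (Matrix Carrier n)
  (A ᵀ) i j = A j i

  1ᴹ : ∀ {n} → Matrix Carrier n
  1ᴹ i j = if does (i Fin.≟ j) then 1# else 0#

  IsOrthogonal : ∀ {n} → Matrix Carrier n → Set ℓ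
  IsOrthogonal A = (A *ᴹ A ᵀ ≈ᴹ 1ᴹ) × (A ᵀ *ᴹ A ≈ᴹ 1ᴹ)

-- ℂ = ℝ[i], as pairs (real part , imaginary part).
module Complex {c ℓ₁ ℓ₂} (ℝ : RealField c ℓ₁ ℓ₂) where
  private
    module ℝ = RealField ℝ

  Carrier : Set c
  Carrier = ℝ.Carrier × ℝ.Carrier

  infixl 7 _*_

  _*_ : Op₂ Carrier
  (a , b) * (c , d) = (a ℝ.* c ℝ.- b ℝ.* d) , (a ℝ.* d ℝ.+ b ℝ.* c)

  1# : Carrier
  1# = ℝ.1# , ℝ.0#

  private
    module Laws where
      module P = CommutativeRing
        (DirectProduct.commutativeRing ℝ.commutativeRing ℝ.commutativeRing)
      open P using (_≈_; _+_)
      open Consequences P.setoid using (comm∧idˡ⇒id; comm∧distrˡ⇒distr)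
      open RingProperties (CommutativeRing.ring ℝ.commutativeRing) using (-1*x≈-x)
      open Solver (CommutativeRing.commutativeSemiring ℝ.commutativeRing)

      m : ℝ.Carrier
      m = ℝ.- ℝ.1#

      -- Multiplication with the minus sign replaced by a factor m = - 1#, which
      -- reduces its laws to identities of commutative semirings.
      _*′_ : Op₂ Carrier
      (a , b) *′ (c , d) = (a ℝ.* c ℝ.+ m ℝ.* (b ℝ.* d)) , (a ℝ.* d ℝ.+ b ℝ.* c)

      *-def : ∀ x y → x * y ≈ x *′ y
      *-def (_ , b) (_ , d) = ℝ.+-congˡ (ℝ.sym (-1*x≈-x (b ℝ.* d))) , ℝ.refl

      *-cong : ∀ {x y u v} → x ≈ y → u ≈ v → x * u ≈ y * v
      *-cong (p , q) (r , s) =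
        ℝ.+-cong (ℝ.*-cong p r) (ℝ.-‿cong (ℝ.*-cong q s)) ,
        ℝ.+-cong (ℝ.*-cong p s) (ℝ.*-cong q r)

      *′-assoc : ∀ x y z → (x *′ y) *′ z ≈ x *′ (y *′ z)
      *′-assoc (a , b) (c , d) (e , f) =
        solve 7 (λ m a b c d e f →
          (a :* c :+ m :* (b :* d)) :* e :+ m :* ((a :* d :+ b :* c) :* f) :=
          a :* (c :* e :+ m :* (d :* f)) :+ m :* (b :* (c :* f :+ d :* e)))
          ℝ.refl m a b c d e f ,
        solve 7 (λ m a b c d e f →
          (a :* c :+ m :* (b :* d)) :* f :+ (a :* d :+ b :* c) :* e :=
          a :* (c :* f :+ d :* e) :+ b :* (c :* e :+ m :* (d :* f)))
          ℝ.refl m a b c d e f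

      *-assoc : ∀ x y z → (x * y) * z ≈ x * (y * z)
      *-assoc x y z = begin
        (x * y) * z    ≈⟨ *-cong (*-def x y) P.refl ⟩
        (x *′ y) * z   ≈⟨ *-def (x *′ y) z ⟩
        (x *′ y) *′ z  ≈⟨ *′-assoc x y z ⟩
        x *′ (y *′ z)  ≈⟨ *-def x (y *′ z) ⟨
        x * (y *′ z)   ≈⟨ *-cong P.refl (*-def y z) ⟨
        x * (y * z)    ∎
        where open ≈-Reasoning P.setoid

      *-comm : ∀ x y → x * y ≈ y * x
      *-comm (a , b) (c , d) =
        ℝ.+-cong (ℝ.*-comm a c) (ℝ.-‿cong (ℝ.*-comm b d)) ,
        ℝ.trans (ℝ.+-comm _ _) (ℝ.+-cong (ℝ.*-comm b c) (ℝ.*-comm a d))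

      *-identityˡ : ∀ x → 1# * x ≈ x
      *-identityˡ x@(a , b) = P.trans (*-def 1# x)
        ( solve 3 (λ m a b → con 1 :* a :+ m :* (con 0 :* b) := a) ℝ.refl m a b
        , solve 2 (λ a b → con 1 :* b :+ con 0 :* a := b) ℝ.refl a b )

      distribˡ : ∀ x y z → x * (y + z) ≈ x * y + x * z
      distribˡ x@(a , b) y@(c , d) z@(e , f) = begin
        x * (y + z)       ≈⟨ *-def x (y + z) ⟩
        x *′ (y + z)      ≈⟨ re , im ⟩
        x *′ y + x *′ z   ≈⟨ P.+-cong (*-def x y) (*-def x z) ⟨
        x * y + x * z     ∎
        where
        open ≈-Reasoning P.setoid
        re = solve 7 (λ m a b c d e f →
          a :* (c :+ e) :+ m :* (b :* (d :+ f)) :=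
          (a :* c :+ m :* (b :* d)) :+ (a :* e :+ m :* (b :* f)))
          ℝ.refl m a b c d e f
        im = solve 6 (λ a b c d e f →
          a :* (d :+ f) :+ b :* (c :+ e) :=
          (a :* d :+ b :* c) :+ (a :* f :+ b :* e))
          ℝ.refl a b c d e f

      *-identity : (∀ x → 1# * x ≈ x) × (∀ x → x * 1# ≈ x)
      *-identity = comm∧idˡ⇒id *-comm *-identityˡ

      distrib : (∀ x y z → x * (y + z) ≈ x * y + x * z) ×
                (∀ x y z → (y + z) * x ≈ y * x + z * x)
      distrib = comm∧distrˡ⇒distr P.+-cong *-comm distribˡ

  commutativeRing : CommutativeRing c ℓ₁
  commutativeRing = record
    { Carrier = Carrier
    ; _≈_     = Laws.P._≈_
    ; _+_     = Laws.P._+_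
    ; _*_     = _*_
    ; -_      = Laws.P.-_
    ; 0#      = Laws.P.0#
    ; 1#      = 1#
    ; isCommutativeRing = record
      { isRing = record
        { +-isAbelianGroup = Laws.P.+-isAbelianGroup
        ; *-cong           = Laws.*-cong
        ; *-assoc          = Laws.*-assoc
        ; *-identity       = Laws.*-identity
        ; distrib          = Laws.distrib
        }
      ; *-comm = Laws.*-comm
      }
    }

  open CommutativeRing commutativeRing public
    hiding (Carrier; _*_; 1#)
  open RawRing rawRing public using (rawSemiring)
  open RawSemiringDefs rawSemiring public using (_^_)

  infix 4 _#_

  _#_ : Rel Carrier ℓ₂
  (a , b) # (c , d) = a ℝ.# c ⊎ b ℝ.# d

  fromℝ : ℝ.Carrier → Carrier
  fromℝ a = a , ℝ.0#

  -- For prime p, the p-th roots of unity other than 1 are the primitive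
  -- ones, among them e^(2πi/p).
  IsNontrivialRootOfUnity : ℕ → Carrier → Set (ℓ₁ ⊔ ℓ₂)
  IsNontrivialRootOfUnity p ζ = (ζ ^ p ≈ 1#) × ζ # 1#

module Adjoin {c ℓ₁ ℓ₂} (ℝ : RealField c ℓ₁ ℓ₂)
              (ζ : Complex.Carrier ℝ) where
  private
    module ℂ = Complex ℝ

  -- The subfield of ℂ generated by ζ.  Closure under inverses puts every
  -- rational number in it.
  data _∈ℚ⟨ζ⟩ : ℂ.Carrier → Set (c ⊔ ℓ₁) where
    ζ∈   : ζ ∈ℚ⟨ζ⟩
    0∈   : ℂ.0# ∈ℚ⟨ζ⟩
    1∈   : ℂ.1# ∈ℚ⟨ζ⟩
    +∈   : ∀ {x y} → x ∈ℚ⟨ζ⟩ → y ∈ℚ⟨ζ⟩ → (x ℂ.+ y) ∈ℚ⟨ζ⟩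
    *∈   : ∀ {x y} → x ∈ℚ⟨ζ⟩ → y ∈ℚ⟨ζ⟩ → (x ℂ.* y) ∈ℚ⟨ζ⟩
    -∈   : ∀ {x} → x ∈ℚ⟨ζ⟩ → (ℂ.- x) ∈ℚ⟨ζ⟩
    inv∈ : ∀ {x y} → x ∈ℚ⟨ζ⟩ → (x ℂ.* y) ℂ.≈ ℂ.1# → y ∈ℚ⟨ζ⟩
    ≈∈   : ∀ {x y} → x ∈ℚ⟨ζ⟩ → x ℂ.≈ y → y ∈ℚ⟨ζ⟩

  Carrier : Set (c ⊔ ℓ₁)
  Carrier = Σ ℂ.Carrier _∈ℚ⟨ζ⟩

  toℂ : Carrier → ℂ.Carrier
  toℂ = proj₁

  rawRing : RawRing (c ⊔ ℓ₁) ℓ₁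
  rawRing = record
    { Carrier = Carrier
    ; _≈_     = λ x y → toℂ x ℂ.≈ toℂ y
    ; _+_     = λ (x , x∈) (y , y∈) → (x ℂ.+ y) , +∈ x∈ y∈
    ; _*_     = λ (x , x∈) (y , y∈) → (x ℂ.* y) , *∈ x∈ y∈
    ; -_      = λ (x , x∈) → (ℂ.- x) , -∈ x∈
    ; 0#      = ℂ.0# , 0∈
    ; 1#      = ℂ.1# , 1∈
    }

  toℂ-isRingMonomorphism :
    RingMorphisms.IsRingMonomorphism rawRing ℂ.rawRing toℂ
  toℂ-isRingMonomorphism = record
    { isRingHomomorphism = record
      { isSemiringHomomorphism = record
        { isNearSemiringHomomorphism = record
          { +-isMonoidHomomorphism = record
            { isMagmaHomomorphism = record
              { isRelHomomorphism = record { cong = λ x≈y → x≈y }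
              ; homo = λ _ _ → ℂ.refl
              }
            ; ε-homo = ℂ.refl
            }
          ; *-homo = λ _ _ → ℂ.refl
          }
        ; 1#-homo = ℂ.refl
        }
      ; -‿homo = λ _ → ℂ.refl
      }
    ; injective = λ x≈y → x≈y
    }

  commutativeRing : CommutativeRing (c ⊔ ℓ₁) ℓ₁
  commutativeRing = record
    { isCommutativeRing =
        RingMonomorphism.isCommutativeRing toℂ-isRingMonomorphism
          ℂ.isCommutativeRing
    }

  open CommutativeRing commutativeRing public
    hiding (Carrier; rawRing)
  open RawRing rawRing public using (rawSemiring)
  open RawSemiringDefs rawSemiring public using (_^_; sum; product)

  ζ′ : Carrier
  ζ′ = ζ , ζ∈

  IsAutomorphism : (Carrier → Carrier) → Set (c ⊔ ℓ₁)
  IsAutomorphism = RingMorphisms.IsRingIsomorphism rawRing rawRing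

-- Intended for ζ with ζ ^ p ≈ 1#.
module Elements {c ℓ₁ ℓ₂} (ℝ : RealField c ℓ₁ ℓ₂)
                (ζ : Complex.Carrier ℝ) (p : ℕ) where
  open Adjoin ℝ ζ

  infix 9 ζ^_

  -- Negative powers use ζ⁻¹ = ζ ^ (p - 1).
  ζ^_ : ℤ → Carrier
  ζ^ (+ k)    = ζ′ ^ k
  ζ^ -[1+ k ] = (ζ′ ^ (p ∸ 1)) ^ suc k

  -- Here j ranges over 0, …, (p - 3)/2.
  α : (r : ℤ) → Carrier
  α r = product {suc ((p ∸ 3) / 2)} (λ j → 1# - ζ^ (r ℤ.^ toℕ j))

  z : (r l : ℤ) → Carrier
  z r l = ζ^ l * α r * (1# - ζ′)

  module Trace (σ : Carrier → Carrier) (n : ℕ) .{{_ : NonZero n}} where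

    open Endo Carrier using () renaming (_^_ to _^∘_)

    σ^ : ℕ → Carrier → Carrier
    σ^ k = σ ^∘ k

    -- Membership in 𝕂, the fixed field of σⁿ.
    _∈𝕂 : Carrier → Set ℓ₁
    y ∈𝕂 = σ^ n y ≈ y

    -- The trace from ℚ(ζ) to 𝕂; the exponents are j n for
    -- j = 1, …, (p - 1)/n.
    Tr : Carrier → Carrier
    Tr y = sum {(p ∸ 1) / n} (λ j → σ^ (suc (toℕ j) ℕ.* n) y)

    x : (r l : ℤ) → Carrier
    x r l = Tr (z r l)

{-# OPTIONS --safe #-}

-- Put ε = -1, ρ = r mod p, m = (p - 1)/2 and β = ζ^λ α.  Since λ(r - 1) ≡ 1,
-- the product α telescopes to σ β = ε β, and α σ^m(α) = N(1 - ζ) = p gives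
-- β² = ε^m p.  Hence σ^k z = ε^k β + w k with w a = ε β ε^a ζ^(ρ^a), and in
-- the trace the terms ε^k β cancel, because n is odd and (p - 1)/n is even:
-- σ^k x is the sum of w over the residue class of k modulo n.  The inner
-- product of two rows of p G is therefore a sum of correlations
-- ∑ₐ w(a + i) w(a + m + b), which are character sums modulo p with value
-- p (p [i = b] - ε^(i + b)); the signs cancel in the sum over b.
--
-- The norm of 1 - ζ and the trace of ζ come from factoring
-- 1 + X + … + X^(p-1) over the conjugates ζ^(ρ^j), whose differences are
-- invertible.  The entries are real because complex conjugation agrees with
-- σ^m on ℚ(ζ) and n divides m.

module Submission where

open import Defs
open import Data.Fin.Base using (toℕ)
open import Data.Integer.Base as ℤ using (ℤ; +_)
open import Data.Nat.Base as ℕ using (ℕ; NonZero)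
open import Data.Nat.Divisibility as ℕ using (_∣_)
open import Data.Nat.Primality using (Prime; prime⇒nonZero)
open import Data.Product.Base using (Σ-syntax; _×_)
open import Relation.Nullary.Negation using (¬_)

open import Algebra.Bundles using (CommutativeMonoid; CommutativeRing; Semiring)
import Algebra.Morphism.Construct.Composition as Composition
import Algebra.Morphism.Construct.Identity as Identity
open import Algebra.Morphism.Structures using (module RingMorphisms)
open import Data.Bool.Base using (if_then_else_)
open import Data.Fin.Base as Fin using (Fin; fromℕ<)
import Data.Fin.Properties as Fin
open import Data.Integer.Base using (-[1+_])
import Data.Integer.Coprimality as ℤ
import Data.Integer.Divisibility.Signed as ℤˢ
import Data.Integer.Properties as ℤ
open import Data.Integer.Tactic.RingSolver using () renaming (solve-∀ to solve-∀ℤ)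
open import Data.Nat.Base using (zero; suc; _∸_)
open import Data.Nat.Divisibility using (divides; ∣⇒≤; ∣1⇒≡1; ∣m⇒∣m*n; m%n≡0⇒n∣m; n∣m⇒m%n≡0; _∣0)
open import Data.Nat.DivMod as ℕ using (_%_; _/_)
open import Data.Nat.Primality using (euclidsLemma; prime⇒irreducible; prime[2]; ¬prime[1])
import Data.Nat.Properties as ℕ
open import Data.Nat.Tactic.RingSolver using (solve-∀)
open import Data.Product.Base using (∃-syntax; _,_; proj₁; proj₂)
open import Data.Sum.Base using (inj₁; inj₂; [_,_]′)
open import Data.Vec.Base using (Vec; []; _∷_; last; replicate)
open import Function.Base using (_∘_; _$_)
import Function.Endo.Propositional as Endo
open import Level using (_⊔_)
open import Relation.Binary.Definitions using (tri<; tri≈; tri>)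
open import Relation.Binary.PropositionalEquality as ≡ using (_≡_; _≢_)
open import Relation.Nullary.Decidable using (does; yes; no; dec-true; dec-false)
open import Relation.Nullary.Negation using (contradiction)

-- Equality of real numbers is not decidable here, so being nonzero gives no inverse. The algebra
-- therefore runs in a commutative ring where every cancellation is by an exhibited unit. Analysis
-- supplies the one starting unit, 1 - ζ: since ζ lies on the unit circle, |1 - ζ|² = 2 (1 - Re ζ),
-- and this is invertible because ζ is apart from 1. Applying σ and multiplying yields all other
-- units that are cancelled. The shift by m in the correlations has a simple origin. A product of
-- two terms of `w` has the exponent ρ^i + ρ^b times ρ^a, whereas a Kronecker delta needs the
-- difference ρ^i - ρ^b. As ρ^m = -1 modulo p and σ^m fixes every σ^k x, replacing the second factor
-- by its image under σ^m changes the sign of ρ^b without changing the product.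

module NumberTheory where
  open import Data.Nat.Base
  open import Data.Nat.DivMod
  open import Data.Nat.Properties
  open ≡ using (refl; sym; trans; cong; cong₂; subst; subst₂; module ≡-Reasoning)

  -- Congruence of natural numbers modulo p

  module Residues (p : ℕ) .{{_ : NonZero p}} where

    infix 4 _≈ₚ_

    _≈ₚ_ : ℕ → ℕ → Set
    a ≈ₚ b = a % p ≡ b % p

    *-congₚ : ∀ {a b c d} → a ≈ₚ b → c ≈ₚ d → a * c ≈ₚ b * d
    *-congₚ {a} {b} {c} {d} e f = trans (%-distribˡ-* a c p)
      (trans (cong₂ (λ u v → (u * v) % p) e f) (sym (%-distribˡ-* b d p)))

    ∣⇒≈0 : ∀ {a} → p ∣ a → a ≈ₚ 0
    ∣⇒≈0 {a} d = trans (n∣m⇒m%n≡0 a p d) (sym (n∣m⇒m%n≡0 0 p (p ∣0)))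

    ≈⇒∣∸ : ∀ {a b} → a ≤ b → a ≈ₚ b → p ∣ b ∸ a
    ≈⇒∣∸ {a} {b} a≤b e = divides (b / p ∸ a / p) $ begin
      b ∸ a                                        ≡⟨ cong₂ _∸_ (m≡m%n+[m/n]*n b p) (m≡m%n+[m/n]*n a p) ⟩
      (b % p + b / p * p) ∸ (a % p + a / p * p)    ≡⟨ cong (λ u → (b % p + b / p * p) ∸ (u + a / p * p)) e ⟩
      (b % p + b / p * p) ∸ (b % p + a / p * p)    ≡⟨ [m+n]∸[m+o]≡n∸o (b % p) _ _ ⟩
      b / p * p ∸ a / p * p                        ≡⟨ *-distribʳ-∸ p (b / p) (a / p) ⟨
      (b / p ∸ a / p) * p                          ∎
      where open ≡-Reasoning

    ∣∸⇒≈ : ∀ {a b} → a ≤ b → p ∣ b ∸ a → a ≈ₚ b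
    ∣∸⇒≈ {a} {b} a≤b d = sym (trans (cong (_% p) (sym (m+[n∸m]≡n a≤b))) (%-remove-+ʳ a d))

    module _ (p-prime : Prime p) where

      cancel-≤ : ∀ {c} → ¬ p ∣ c → ∀ {a b} → a ≤ b → a * c ≈ₚ b * c → a ≈ₚ b
      cancel-≤ {c} p∤c {a} {b} a≤b e with euclidsLemma (b ∸ a) c p-prime
        (subst (p ∣_) (sym (*-distribʳ-∸ c b a)) (≈⇒∣∸ (*-monoˡ-≤ c a≤b) e))
      ... | inj₁ d = ∣∸⇒≈ a≤b d
      ... | inj₂ d = contradiction d p∤c

      cancel : ∀ {c} → ¬ p ∣ c → ∀ a b → a * c ≈ₚ b * c → a ≈ₚ b
      cancel p∤c a b e with ≤-total a b
      ... | inj₁ a≤b = cancel-≤ p∤c a≤b e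
      ... | inj₂ b≤a = sym (cancel-≤ p∤c b≤a (sym e))

      -- With a = 1 + u the difference a² - 1 is u (2 + u), free of truncated subtraction. If p
      -- divided u, then a would be 1 modulo p, so p divides 2 + u = 1 + a.
      sqrt1 : ∀ a → ¬ p ∣ a → ¬ 1 ≈ₚ a → a * a ≈ₚ 1 → p ∣ 1 + a
      sqrt1 zero    p∤0 _   _ = contradiction (p ∣0) p∤0
      sqrt1 (suc u) _   1≉a e
        with euclidsLemma u (2 + u) p-prime (subst (p ∣_) (lem u) (≈⇒∣∸ {1} (s≤s z≤n) (sym e)))
        where
        lem : ∀ u → u + u * suc u ≡ u * (2 + u)
        lem = solve-∀
      ... | inj₁ d = contradiction (sym (%-remove-+ʳ 1 d)) 1≉a
      ... | inj₂ d = d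

  -- Powers of a primitive root modulo p = 2m + 1

  module PrimitiveRoot (m : ℕ) .{{m≢0 : NonZero m}} (p : ℕ) .{{p≢0 : NonZero p}}
    (p≡1+2m : p ≡ suc (m + m)) (p-prime : Prime p) (ρ : ℕ)
    (p∤ρ : ¬ p ∣ ρ)
    (log : ∀ a → ¬ p ∣ a → ∃[ k ] ρ ^ k % p ≡ a % p)
    where

    open Residues p

    p∤^ : ∀ k → ¬ p ∣ ρ ^ k
    p∤^ zero    d = contradiction (subst Prime (∣1⇒≡1 d) p-prime) ¬prime[1]
    p∤^ (suc k) d with euclidsLemma ρ (ρ ^ k) p-prime d
    ... | inj₁ d′ = p∤ρ d′
    ... | inj₂ d′ = p∤^ k d′

    <p⇒∤ : ∀ {a} .{{_ : NonZero a}} → a < p → ¬ p ∣ a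
    <p⇒∤ a<p d = <⇒≱ a<p (∣⇒≤ d)

    1+i<p : ∀ {i} → i < m + m → suc i < p
    1+i<p {i} i< = subst (suc i <_) (sym p≡1+2m) (s<s i<)

    1≈^-* : ∀ {t} → 1 ≈ₚ ρ ^ t → ∀ q → ρ ^ (q * t) ≈ₚ 1
    1≈^-* e zero    = refl
    1≈^-* {t} e (suc q) = trans (cong (_% p) (^-distribˡ-+-* ρ t (q * t)))
      (*-congₚ {ρ ^ t} {1} {ρ ^ (q * t)} {1} (sym e) (1≈^-* e q))

    ^-% : ∀ {t} .{{_ : NonZero t}} → 1 ≈ₚ ρ ^ t → ∀ k → ρ ^ k ≈ₚ ρ ^ (k % t)
    ^-% {t} e k = begin
      ρ ^ k % p                              ≡⟨ cong (λ u → ρ ^ u % p) (m≡m%n+[m/n]*n k t) ⟩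
      ρ ^ (k % t + k / t * t) % p            ≡⟨ cong (_% p) (^-distribˡ-+-* ρ (k % t) (k / t * t)) ⟩
      (ρ ^ (k % t) * ρ ^ (k / t * t)) % p    ≡⟨ *-congₚ {ρ ^ (k % t)} {ρ ^ (k % t)} {ρ ^ (k / t * t)} {1} refl (1≈^-* e (k / t)) ⟩
      (ρ ^ (k % t) * 1) % p                  ≡⟨ cong (_% p) (*-identityʳ _) ⟩
      ρ ^ (k % t) % p                        ∎
      where open ≡-Reasoning

    -- If t < m + m, the residues modulo t of the discrete logarithms cannot
    -- separate the m + m units modulo p.
    order-≥ : ∀ t .{{_ : NonZero t}} → 1 ≈ₚ ρ ^ t → m + m ≤ t
    order-≥ t e = ≮⇒≥ λ t<2m →
      let i , j , i<j , eq = Fin.pigeonhole t<2m f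
          k₁ = proj₁ (lg i)
          k₂ = proj₁ (lg j)
          k₁≡k₂ : k₁ % t ≡ k₂ % t
          k₁≡k₂ = trans (sym (Fin.toℕ-fromℕ< _)) (trans (cong toℕ eq) (Fin.toℕ-fromℕ< _))
          open ≡-Reasoning
      in <⇒≢ (s<s i<j) $ begin
        suc (toℕ i)            ≡⟨ m<n⇒m%n≡m (1+i<p (Fin.toℕ<n i)) ⟨
        suc (toℕ i) % p        ≡⟨ proj₂ (lg i) ⟨
        ρ ^ k₁ % p             ≡⟨ ^-% e k₁ ⟩
        ρ ^ (k₁ % t) % p       ≡⟨ cong (λ u → ρ ^ u % p) k₁≡k₂ ⟩
        ρ ^ (k₂ % t) % p       ≡⟨ ^-% e k₂ ⟨
        ρ ^ k₂ % p             ≡⟨ proj₂ (lg j) ⟩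
        suc (toℕ j) % p        ≡⟨ m<n⇒m%n≡m (1+i<p (Fin.toℕ<n j)) ⟩
        suc (toℕ j)            ∎
      where
      lg : (i : Fin (m + m)) → ∃[ k ] ρ ^ k ≈ₚ suc (toℕ i)
      lg i = log (suc (toℕ i)) (<p⇒∤ (1+i<p (Fin.toℕ<n i)))
      f : Fin (m + m) → Fin t
      f i = fromℕ< (m%n<n (proj₁ (lg i)) t)

    ^-cancel : ∀ {i j} → i ≤ j → ρ ^ i ≈ₚ ρ ^ j → 1 ≈ₚ ρ ^ (j ∸ i)
    ^-cancel {i} {j} i≤j e = cancel p-prime (p∤^ i) 1 (ρ ^ (j ∸ i))
      (trans (cong (_% p) (*-identityˡ (ρ ^ i))) (trans e (cong (_% p)
        (trans (cong (ρ ^_) (sym (m∸n+n≡m i≤j))) (^-distribˡ-+-* ρ (j ∸ i) i)))))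

    private
      ≢-< : ∀ {i j} → i < j → j < m + m → ¬ ρ ^ i ≈ₚ ρ ^ j
      ≢-< {i} {j} i<j j<2m e = <⇒≱ j<2m $ ≤-trans
        (order-≥ (j ∸ i) {{>-nonZero (m<n⇒0<n∸m i<j)}} (^-cancel (<⇒≤ i<j) e)) (m∸n≤m j i)

    ^-injective : ∀ {i j} → i < m + m → j < m + m → ρ ^ i ≈ₚ ρ ^ j → i ≡ j
    ^-injective {i} {j} i< j< e with <-cmp i j
    ... | tri< i<j _ _ = contradiction e (≢-< i<j j<)
    ... | tri≈ _ i≡j _ = i≡j
    ... | tri> _ _ j<i = contradiction (sym e) (≢-< j<i i<)

    -- Two of the p powers ρ^0, …, ρ^(p-1) agree modulo p; by order-≥ these are
    -- the first and the last.
    fermat : ρ ^ (m + m) ≈ₚ 1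
    fermat =
      let i , j , i<j , eq = Fin.pigeonhole (subst (m + m <_) (sym p≡1+2m) ≤-refl) f
          1≈ρᵗ = ^-cancel (<⇒≤ i<j) (f-inj {i} {j} eq)
          j∸i≡2m = ≤-antisym (≤-trans (m∸n≤m (toℕ j) (toℕ i)) (s≤s⁻¹ (subst (toℕ j <_) p≡1+2m (Fin.toℕ<n j))))
                    (order-≥ (toℕ j ∸ toℕ i) {{>-nonZero (m<n⇒0<n∸m i<j)}} 1≈ρᵗ)
      in sym (subst (λ u → 1 ≈ₚ ρ ^ u) j∸i≡2m 1≈ρᵗ)
      where
      nz : ∀ k → NonZero (ρ ^ k % p)
      nz k = ≢-nonZero λ e → p∤^ k (m%n≡0⇒n∣m _ p e)
      bound : ∀ k → pred (ρ ^ k % p) < m + m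
      bound k = s<s⁻¹ (subst₂ _<_ (sym (suc-pred (ρ ^ k % p) {{nz k}})) p≡1+2m (m%n<n (ρ ^ k) p))
      f : Fin p → Fin (m + m)
      f i = fromℕ< (bound (toℕ i))
      f-inj : ∀ {i j} → f i ≡ f j → ρ ^ toℕ i ≈ₚ ρ ^ toℕ j
      f-inj {i} {j} e = pred-injective {{nz (toℕ i)}} {{nz (toℕ j)}}
        (trans (sym (Fin.toℕ-fromℕ< (bound (toℕ i)))) (trans (cong toℕ e) (Fin.toℕ-fromℕ< (bound (toℕ j)))))

    -- The square of ρ^m is 1 by `fermat`, while ρ^m itself is not 1, because m is smaller than the
    -- order 2m; the remaining square root of 1 is -1.
    half : p ∣ 1 + ρ ^ m
    half = sqrt1 p-prime (ρ ^ m) (p∤^ m)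
      (λ e → <⇒≱ (m<m+n m (>-nonZero⁻¹ m)) (order-≥ m e))
      (trans (cong (_% p) (sym (^-distribˡ-+-* ρ m m))) fermat)

    -- By `half`, ρ^(m + j) serves as -ρ^j, so that differences of powers can be written as sums in
    -- ℕ.
    ∣-sum : ∀ j → p ∣ ρ ^ j + ρ ^ (m + j)
    ∣-sum j = subst (p ∣_) (sym (cong (λ u → ρ ^ j + u) (^-distribˡ-+-* ρ m j))) (∣m⇒∣m*n (ρ ^ j) half)

    -- Modulo p the sum is ρ^i - ρ^j, and powers with exponents below 2m are distinct.
    ∤-sum : ∀ {i j} → i < m + m → j < m + m → i ≢ j → ¬ p ∣ ρ ^ i + ρ ^ (m + j)
    ∤-sum {i} {j} i< j< i≢j d = i≢j $ ^-injective i< j< $ begin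
      ρ ^ i % p                            ≡⟨ %-remove-+ʳ (ρ ^ i) (∣-sum j) ⟨
      (ρ ^ i + (ρ ^ j + ρ ^ (m + j))) % p  ≡⟨ cong (_% p) (lem (ρ ^ i) (ρ ^ j) _) ⟩
      (ρ ^ j + (ρ ^ i + ρ ^ (m + j))) % p  ≡⟨ %-remove-+ʳ (ρ ^ j) d ⟩
      ρ ^ j % p                            ∎
      where
      open ≡-Reasoning
      lem : ∀ a b c → a + (b + c) ≡ b + (a + c)
      lem = solve-∀

open NumberTheory

-- From integers to natural representatives modulo p

module IntegerResidues (p : ℕ) .{{_ : NonZero p}} where
  open Residues p

  private
    by : ∀ {x y} → x ≡ y → + p ℤˢ.∣ x → + p ℤˢ.∣ y
    by = ≡.subst (+ p ℤˢ.∣_)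

  mod⇒∣ : ∀ a b → a ≡ b [mod p ] → + p ℤˢ.∣ a ℤ.- b
  mod⇒∣ a b = ℤˢ.∣ᵤ⇒∣

  mod-refl : ∀ {a} → a ≡ a [mod p ]
  mod-refl {a} = ℤˢ.∣⇒∣ᵤ (by (≡.sym (ℤ.+-inverseʳ a)) (ℤˢ.divides (+ 0) ≡.refl))

  mod-trans : ∀ {a b c} → a ≡ b [mod p ] → b ≡ c [mod p ] → a ≡ c [mod p ]
  mod-trans {a} {b} {c} e f = ℤˢ.∣⇒∣ᵤ (by (lem a b c) (ℤˢ.∣m∣n⇒∣m+n (mod⇒∣ a b e) (mod⇒∣ b c f)))
    where
    lem : ∀ a b c → (a ℤ.- b) ℤ.+ (b ℤ.- c) ≡ a ℤ.- c
    lem = solve-∀ℤ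

  mod-sym : ∀ {a b} → a ≡ b [mod p ] → b ≡ a [mod p ]
  mod-sym {a} {b} e = ℤˢ.∣⇒∣ᵤ (by (lem a b) (ℤˢ.∣m⇒∣-m (mod⇒∣ a b e)))
    where
    lem : ∀ a b → ℤ.- (a ℤ.- b) ≡ b ℤ.- a
    lem = solve-∀ℤ

  mod-+ : ∀ {a b c d} → a ≡ b [mod p ] → c ≡ d [mod p ] → a ℤ.+ c ≡ b ℤ.+ d [mod p ]
  mod-+ {a} {b} {c} {d} e f = ℤˢ.∣⇒∣ᵤ (by (lem a b c d) (ℤˢ.∣m∣n⇒∣m+n (mod⇒∣ a b e) (mod⇒∣ c d f)))
    where
    lem : ∀ a b c d → (a ℤ.- b) ℤ.+ (c ℤ.- d) ≡ (a ℤ.+ c) ℤ.- (b ℤ.+ d)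
    lem = solve-∀ℤ

  mod-* : ∀ {a b c d} → a ≡ b [mod p ] → c ≡ d [mod p ] → a ℤ.* c ≡ b ℤ.* d [mod p ]
  mod-* {a} {b} {c} {d} e f = ℤˢ.∣⇒∣ᵤ (by (lem a b c d)
    (ℤˢ.∣m∣n⇒∣m+n (ℤˢ.∣m⇒∣m*n c (mod⇒∣ a b e)) (ℤˢ.∣n⇒∣m*n b (mod⇒∣ c d f))))
    where
    lem : ∀ a b c d → (a ℤ.- b) ℤ.* c ℤ.+ b ℤ.* (c ℤ.- d) ≡ a ℤ.* c ℤ.- b ℤ.* d
    lem = solve-∀ℤ

  mod⇒≈ₚ : ∀ {a b} → + a ≡ + b [mod p ] → a ≈ₚ b
  mod⇒≈ₚ {a} {b} e with ℕ.≤-total a b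
  ... | inj₁ a≤b = ∣∸⇒≈ a≤b (≡.subst (p ∣_) (≡.trans (≡.cong ℤ.∣_∣ (ℤ.m-n≡m⊖n a b)) (ℤ.∣⊖∣-≤ a≤b)) e)
  ... | inj₂ b≤a = ≡.sym (∣∸⇒≈ b≤a (≡.subst (p ∣_)
    (≡.trans (≡.cong ℤ.∣_∣ (ℤ.m-n≡m⊖n a b)) (≡.trans (ℤ.∣m⊖n∣≡∣n⊖m∣ a b) (ℤ.∣⊖∣-≤ b≤a))) e))

  -- The exponent with which ζ^ a is defined in Elements.
  rep : ℤ → ℕ
  rep (+ k)    = k
  rep -[1+ k ] = (p ∸ 1) ℕ.* suc k

  rep-mod : ∀ a → + rep a ≡ a [mod p ]
  rep-mod (+ k)    = mod-refl {+ k}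
  -- Subtracting the negative number adds k + 1, and (p - 1)(k + 1) + (k + 1) = p (k + 1).
  rep-mod -[1+ k ] = ≡.subst (p ∣_) (≡.sym eq) (ℕ.m∣m*n (suc k))
    where
    eq : (p ∸ 1) ℕ.* suc k ℕ.+ suc k ≡ p ℕ.* suc k
    eq = ≡.trans (ℕ.+-comm _ (suc k)) (≡.cong (ℕ._* suc k) (ℕ.suc-pred p))

module RootRepresentative (p : ℕ) .{{_ : NonZero p}} (p-prime : Prime p) (r : ℤ) (prim : IsPrimitiveRoot r p) where
  open Residues p
  open IntegerResidues p

  ρ : ℕ
  ρ = rep r

  ^-mod : ∀ k → + (ρ ℕ.^ k) ≡ r ℤ.^ k [mod p ]
  ^-mod zero    = mod-refl {+ 1}
  ^-mod (suc k) = ≡.subst (λ u → u ≡ r ℤ.* r ℤ.^ k [mod p ]) (≡.sym (ℤ.pos-* ρ (ρ ℕ.^ k)))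
    (mod-* {+ ρ} {r} {+ (ρ ℕ.^ k)} {r ℤ.^ k} (rep-mod r) (^-mod k))

  rep-^ : ∀ k → rep (r ℤ.^ k) ≈ₚ ρ ℕ.^ k
  rep-^ k = mod⇒≈ₚ (mod-trans {+ rep (r ℤ.^ k)} {r ℤ.^ k} {+ (ρ ℕ.^ k)}
    (rep-mod (r ℤ.^ k)) (mod-sym {+ (ρ ℕ.^ k)} {r ℤ.^ k} (^-mod k)))

  p∤ρ : ¬ p ∣ ρ
  p∤ρ p∣ρ = contradiction (≡.subst Prime (proj₁ prim (p∣r , ℕ.∣-refl)) p-prime) ¬prime[1]
    where
    lem : ∀ a b → b ℤ.- (b ℤ.- a) ≡ a
    lem = solve-∀ℤ
    p∣r : p ∣ ℤ.∣ r ∣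
    p∣r = ℤˢ.∣⇒∣ᵤ {+ p} {r} (≡.subst (+ p ℤˢ.∣_) (lem r (+ ρ))
      (ℤˢ.∣m∣n⇒∣m-n (ℤˢ.∣ᵤ⇒∣ {+ p} {+ ρ} p∣ρ) (mod⇒∣ (+ ρ) r (rep-mod r))))

  log : ∀ a → ¬ p ∣ a → ∃[ k ] ρ ℕ.^ k ≈ₚ a
  log a p∤a =
    let k , e = proj₂ prim (+ a) coprime
    in k , mod⇒≈ₚ (mod-trans {+ (ρ ℕ.^ k)} {r ℤ.^ k} {+ a} (^-mod k) e)
    where
    coprime : ℤ.Coprime (+ a) (+ p)
    coprime {d} (d∣a , d∣p) with prime⇒irreducible p-prime d∣p
    ... | inj₁ d≡1 = d≡1
    ... | inj₂ d≡p = contradiction (≡.subst (_∣ a) d≡p d∣a) p∤a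

  -- Adding λ to both sides of λ(ρ - 1) = 1 removes the subtraction. In this form the congruence
  -- says that σ multiplies ζ^λ by ζ.
  rep-l : ∀ l → l ℤ.* (r ℤ.- + 1) ≡ + 1 [mod p ] → ρ ℕ.* rep l ≈ₚ rep l ℕ.+ 1
  rep-l l e = mod⇒≈ₚ (≡.subst₂ (λ u v → u ≡ v [mod p ]) lhs rhs
    (mod-+ {l′ ℤ.* (+ ρ ℤ.- + 1)} {+ 1} {l′} {l′}
      (mod-trans {l′ ℤ.* (+ ρ ℤ.- + 1)} {l ℤ.* (r ℤ.- + 1)} {+ 1}
        (mod-* {l′} {l} {+ ρ ℤ.- + 1} {r ℤ.- + 1} (rep-mod l)
          (mod-+ {+ ρ} {r} {ℤ.- + 1} {ℤ.- + 1} (rep-mod r) (mod-refl {ℤ.- + 1}))) e)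
      (mod-refl {l′})))
    where
    l′ = + rep l
    lem : ∀ ρ l → l ℤ.* (ρ ℤ.- + 1) ℤ.+ l ≡ ρ ℤ.* l
    lem = solve-∀ℤ
    lhs : l′ ℤ.* (+ ρ ℤ.- + 1) ℤ.+ l′ ≡ + (ρ ℕ.* rep l)
    lhs = ≡.trans (lem (+ ρ) l′) (≡.sym (ℤ.pos-* ρ (rep l)))
    rhs : + 1 ℤ.+ l′ ≡ + (rep l ℕ.+ 1)
    rhs = ≡.cong +_ (ℕ.+-comm 1 (rep l))

odd-half : ∀ a → ¬ 2 ∣ a → ∃[ q ] a ≡ suc (q ℕ.+ q)
odd-half a 2∤a = a / 2 , ≡.trans (ℕ.m≡m%n+[m/n]*n a 2) (≡.cong₂ ℕ._+_ a%2≡1 (lem (a / 2)))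
  where
  lem : ∀ q → q ℕ.* 2 ≡ q ℕ.+ q
  lem = solve-∀
  a%2≡1 : a % 2 ≡ 1
  a%2≡1 with a % 2 in eq | ℕ.m%n<n a 2
  ... | 0           | _ = contradiction (ℕ.m%n≡0⇒n∣m a 2 eq) 2∤a
  ... | 1           | _ = ≡.refl
  ... | suc (suc _) | ℕ.s<s (ℕ.s<s ())

-- Sums and products over initial segments of ℕ

module RangeSum {c ℓ} (M : CommutativeMonoid c ℓ) where
  open CommutativeMonoid M
  open import Algebra.Properties.CommutativeMonoid.Sum M public
    using (sum; sum-cong-≋; ∑-comm; ∑-distrib-+)
  open import Relation.Binary.Reasoning.Setoid setoid

  -- The summand lives on all of ℕ, so that shifts and periods of the index need no casts between
  -- finite types. The multiplicative monoid of a ring turns the same notion into a product.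
  ∑< : ℕ → (ℕ → Carrier) → Carrier
  ∑< n f = sum {n} (λ i → f (toℕ i))

  ∑<-cong : ∀ n {f g} → (∀ i → f i ≈ g i) → ∑< n f ≈ ∑< n g
  ∑<-cong n e = sum-cong-≋ {n} (λ i → e (toℕ i))

  ∑<-cong-< : ∀ n {f g} → (∀ {i} → i ℕ.< n → f i ≈ g i) → ∑< n f ≈ ∑< n g
  ∑<-cong-< zero    e = refl
  ∑<-cong-< (suc n) e = ∙-cong (e ℕ.z<s) (∑<-cong-< n (λ i< → e (ℕ.s<s i<)))

  ∑<-comm : ∀ m n (f : ℕ → ℕ → Carrier) →
            ∑< m (λ i → ∑< n (f i)) ≈ ∑< n (λ j → ∑< m (λ i → f i j))
  ∑<-comm m n f = ∑-comm {m} {n} (λ i j → f (toℕ i) (toℕ j))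

  ∑<-snoc : ∀ n f → ∑< (suc n) f ≈ ∑< n f ∙ f n
  ∑<-snoc zero    f = trans (identityʳ _) (sym (identityˡ _))
  ∑<-snoc (suc n) f = trans (∙-congˡ (∑<-snoc n (f ∘ suc))) (sym (assoc _ _ _))

  ∑<-+ : ∀ m n f → ∑< (m ℕ.+ n) f ≈ ∑< m f ∙ ∑< n (λ i → f (m ℕ.+ i))
  ∑<-+ zero    n f = sym (identityˡ _)
  ∑<-+ (suc m) n f = trans (∙-congˡ (∑<-+ m n (f ∘ suc))) (sym (assoc _ _ _))

  -- Division with remainder by n enumerates the range. This fuses the index of the trace with the
  -- column index of the matrix.
  ∑<-* : ∀ d n f → ∑< (d ℕ.* n) f ≈ ∑< d (λ j → ∑< n (λ k → f (j ℕ.* n ℕ.+ k)))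
  ∑<-* zero    n f = refl
  ∑<-* (suc d) n f = begin
    ∑< (n ℕ.+ d ℕ.* n) f                                                  ≈⟨ ∑<-+ n (d ℕ.* n) f ⟩
    ∑< n f ∙ ∑< (d ℕ.* n) (λ i → f (n ℕ.+ i))                             ≈⟨ ∙-congˡ (∑<-* d n (λ i → f (n ℕ.+ i))) ⟩
    ∑< n f ∙ ∑< d (λ j → ∑< n (λ k → f (n ℕ.+ (j ℕ.* n ℕ.+ k))))          ≈⟨ ∙-congˡ (∑<-cong d λ j → ∑<-cong n λ k →
                                                                              reflexive (≡.cong f (ℕ.+-assoc n (j ℕ.* n) k))) ⟨
    ∑< n f ∙ ∑< d (λ j → ∑< n (λ k → f (n ℕ.+ j ℕ.* n ℕ.+ k)))            ∎

  ∑<-rotate : ∀ n f → f n ≈ f 0 → ∑< n (f ∘ suc) ≈ ∑< n f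
  ∑<-rotate zero    f e = refl
  ∑<-rotate (suc n) f e = begin
    ∑< (suc n) (f ∘ suc)             ≈⟨ ∑<-snoc n (f ∘ suc) ⟩
    ∑< n (f ∘ suc) ∙ f (suc n)       ≈⟨ ∙-congˡ e ⟩
    ∑< n (f ∘ suc) ∙ f 0             ≈⟨ comm _ _ ⟩
    ∑< (suc n) f                     ∎

  -- Each unit step is a rotation: it drops one boundary term and gains another, and periodicity
  -- makes the two equal.
  ∑<-shift : ∀ n f → (∀ a → f (a ℕ.+ n) ≈ f a) → ∀ k → ∑< n (λ i → f (i ℕ.+ k)) ≈ ∑< n f
  ∑<-shift n f per zero    = ∑<-cong n λ i → reflexive (≡.cong f (ℕ.+-identityʳ i))
  ∑<-shift n f per (suc k) = begin
    ∑< n (λ i → f (i ℕ.+ suc k))     ≈⟨ ∑<-cong n (λ i → reflexive (≡.cong f (ℕ.+-suc i k))) ⟩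
    ∑< n (λ i → f (suc i ℕ.+ k))     ≈⟨ ∑<-rotate n (λ i → f (i ℕ.+ k))
                                         (trans (reflexive (≡.cong f (ℕ.+-comm n k))) (per k)) ⟩
    ∑< n (λ i → f (i ℕ.+ k))         ≈⟨ ∑<-shift n f per k ⟩
    ∑< n f                           ∎

-- Units and signs in a commutative ring

module RingFacts {c ℓ} (R : CommutativeRing c ℓ) where
  open CommutativeRing R
  open import Algebra.Properties.Ring ring public using (-1*x≈-x; -‿involutive; -0#≈0#; x≈y⇒x∙y⁻¹≈ε)
  open import Algebra.Properties.Semiring.Exp semiring public
  open import Algebra.Solver.Ring.NaturalCoefficients.Default commutativeSemiring public
    using (solve; con; _:=_; _:+_; _:*_)
  open import Relation.Binary.Reasoning.Setoid setoid

  Unit : Carrier → Set _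
  Unit x = ∃[ u ] u * x ≈ 1#

  unit-resp : ∀ {x y} → x ≈ y → Unit x → Unit y
  unit-resp x≈y (u , ux≈1) = u , trans (*-congˡ (sym x≈y)) ux≈1

  unit-* : ∀ {x y} → Unit x → Unit y → Unit (x * y)
  unit-* {x} {y} (u , ux≈1) (v , vy≈1) = u * v , (begin
    u * v * (x * y)      ≈⟨ solve 4 (λ u v x y → u :* v :* (x :* y) := u :* x :* (v :* y)) refl u v x y ⟩
    u * x * (v * y)      ≈⟨ *-cong ux≈1 vy≈1 ⟩
    1# * 1#              ≈⟨ *-identityˡ 1# ⟩
    1#                   ∎)

  unit-cancelˡ : ∀ {x} → Unit x → ∀ {y z} → x * y ≈ x * z → y ≈ z
  unit-cancelˡ {x} (u , ux≈1) {y} {z} e = trans (sym (undo y)) (trans (*-congˡ e) (undo z))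
    where
    undo : ∀ y → u * (x * y) ≈ y
    undo y = trans (sym (*-assoc u x y)) (trans (*-congʳ ux≈1) (*-identityˡ y))

  unit-cancel-0 : ∀ {x} → Unit x → ∀ {y} → x * y ≈ 0# → y ≈ 0#
  unit-cancel-0 {x} U e = unit-cancelˡ U (trans e (sym (zeroʳ x)))

  -- With subtraction rewritten as addition of an `ε`-multiple, sign computations become commutative
  -- semiring identities in a variable `ε`, together with `ε*ε≈1` and `ε+1≈0`.
  ε : Carrier
  ε = - 1#

  x-y≈x+εy : ∀ x y → x - y ≈ x + ε * y
  x-y≈x+εy x y = +-congˡ (sym (-1*x≈-x y))

  ε*ε≈1 : ε * ε ≈ 1#
  ε*ε≈1 = trans (-1*x≈-x ε) (-‿involutive 1#)

  ε+1≈0 : ε + 1# ≈ 0#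
  ε+1≈0 = -‿inverseˡ 1#

  y+[x-y]≈x : ∀ x y → y + (x - y) ≈ x
  y+[x-y]≈x x y = begin
    y + (x - y)    ≈⟨ +-congˡ (+-comm x (- y)) ⟩
    y + (- y + x)  ≈⟨ +-assoc y (- y) x ⟨
    y - y + x      ≈⟨ +-congʳ (-‿inverseʳ y) ⟩
    0# + x         ≈⟨ +-identityˡ x ⟩
    x              ∎

-- Monic polynomials: factorisation and the sum of the roots

module MonicPolynomial {c ℓ} (R : CommutativeRing c ℓ) where
  open CommutativeRing R
  open RingFacts R
  open RangeSum +-commutativeMonoid using (∑<)
  open RangeSum *-commutativeMonoid using () renaming (∑< to ∏<)
  open import Algebra.Definitions.RawSemiring (Semiring.rawSemiring semiring) using () renaming (_×_ to _×ℕ_)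
  open import Relation.Binary.Reasoning.Setoid setoid

  -- The vector lists the coefficients of a monic polynomial, constant term
  -- first and without the leading 1.
  eval : ∀ {d} → Vec Carrier d → Carrier → Carrier
  eval []       X = 1#
  eval (c ∷ cs) X = c + X * eval cs X

  eval-cong : ∀ {d} (f : Vec Carrier d) {X Y} → X ≈ Y → eval f X ≈ eval f Y
  eval-cong []       e = refl
  eval-cong (c ∷ cs) e = +-congˡ (*-cong e (eval-cong cs e))

  -- Horner's scheme: for f = c + X g, the quotient of f(X) - f(a) by X - a has constant term g(a),
  -- and its higher part is the same quotient for g.
  quot : ∀ {d} → Carrier → Vec Carrier (suc d) → Vec Carrier d
  quot a (c ∷ [])          = []
  quot a (c ∷ cs@(_ ∷ _))  = eval cs a ∷ quot a cs

  -- Writing the argument as a + t makes the divisor t, so each inductive step is a semiring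
  -- identity.
  division : ∀ {d} a t (f : Vec Carrier (suc d)) →
             eval f (a + t) ≈ eval f a + t * eval (quot a f) (a + t)
  division a t (c ∷ []) = solve 3 (λ a t c →
    c :+ (a :+ t) :* con 1 := (c :+ a :* con 1) :+ t :* con 1) refl a t c
  division a t (c ∷ cs@(_ ∷ _)) = trans (+-congˡ (*-congˡ (division a t cs)))
    (solve 5 (λ a t c h g → c :+ (a :+ t) :* (h :+ t :* g) :=
      (c :+ a :* h) :+ t :* (h :+ (a :+ t) :* g)) refl a t c (eval cs a) (eval (quot a cs) (a + t)))

  factor : ∀ {d} a (f : Vec Carrier (suc d)) → eval f a ≈ 0# →
           ∀ X → eval f X ≈ (X - a) * eval (quot a f) X
  factor a f fa≈0 X = begin
    eval f X                                           ≈⟨ eval-cong f (y+[x-y]≈x X a) ⟨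
    eval f (a + (X - a))                               ≈⟨ division a (X - a) f ⟩
    eval f a + (X - a) * eval (quot a f) (a + (X - a)) ≈⟨ +-cong fa≈0 (*-congˡ (eval-cong (quot a f) (y+[x-y]≈x X a))) ⟩
    0# + (X - a) * eval (quot a f) X                   ≈⟨ +-identityˡ _ ⟩
    (X - a) * eval (quot a f) X                        ∎

  -- `last` picks the coefficient just below the leading 1. Multiplying a monic quotient by X - a
  -- lowers that coefficient by a.
  last-quot : ∀ {d} a (f : Vec Carrier (suc (suc d))) → last (quot a f) ≈ last f + a
  last-quot a (c ∷ c′ ∷ [])              = +-congˡ (*-identityʳ a)
  last-quot a (c ∷ cs@(c′ ∷ c″ ∷ cs′))   = last-quot a cs

  private
    quot-roots : ∀ {d} (f : Vec Carrier (suc d)) (a : ℕ → Carrier) →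
      (∀ {i} → i ℕ.< suc d → eval f (a i) ≈ 0#) →
      (∀ {i j} → i ℕ.< j → j ℕ.< suc d → Unit (a j - a i)) →
      ∀ {i} → i ℕ.< d → eval (quot (a 0) f) (a (suc i)) ≈ 0#
    quot-roots f a root sep i<d = unit-cancel-0 (sep ℕ.z<s (ℕ.s<s i<d))
      (trans (sym (factor (a 0) f (root {0} ℕ.z<s) (a (suc _)))) (root (ℕ.s<s i<d)))

  -- Roots are split off one at a time. A later root stays a root of the quotient because its
  -- difference from the root removed is a unit; this replaces the absence of zero divisors.
  factorisation : ∀ {d} (f : Vec Carrier d) (a : ℕ → Carrier) →
    (∀ {i} → i ℕ.< d → eval f (a i) ≈ 0#) →
    (∀ {i j} → i ℕ.< j → j ℕ.< d → Unit (a j - a i)) →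
    ∀ X → eval f X ≈ ∏< d (λ i → X - a i)
  factorisation {zero}  []  a root sep X = refl
  factorisation {suc d} f   a root sep X = trans (factor (a 0) f (root {0} ℕ.z<s) X)
    (*-congˡ (factorisation (quot (a 0) f) (a ∘ suc) (quot-roots f a root sep)
      (λ i<j j<d → sep (ℕ.s<s i<j) (ℕ.s<s j<d)) X))

  -- Every root split off is added to the subleading coefficient by `last-quot`, until the
  -- polynomial is linear.
  vieta : ∀ {d} (f : Vec Carrier (suc d)) (a : ℕ → Carrier) →
    (∀ {i} → i ℕ.< suc d → eval f (a i) ≈ 0#) →
    (∀ {i j} → i ℕ.< j → j ℕ.< suc d → Unit (a j - a i)) →
    ∑< (suc d) a + last f ≈ 0#
  vieta {zero}  (c ∷ []) a root sep = trans
    (solve 2 (λ a c → a :+ con 0 :+ c := c :+ a :* con 1) refl (a 0) c) (root {0} ℕ.z<s)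
  vieta {suc d} f a root sep = begin
    a 0 + ∑< (suc d) (a ∘ suc) + last f           ≈⟨ solve 3 (λ x s l → x :+ s :+ l := s :+ (l :+ x)) refl
                                                      (a 0) (∑< (suc d) (a ∘ suc)) (last f) ⟩
    ∑< (suc d) (a ∘ suc) + (last f + a 0)         ≈⟨ +-congˡ (last-quot (a 0) f) ⟨
    ∑< (suc d) (a ∘ suc) + last (quot (a 0) f)    ≈⟨ vieta (quot (a 0) f) (a ∘ suc) (quot-roots f a root sep)
                                                      (λ i<j j<d → sep (ℕ.s<s i<j) (ℕ.s<s j<d)) ⟩
    0#                                            ∎

  geometric : ∀ d → Vec Carrier d
  geometric d = replicate d 1#

  -- Both sides are 1 + X + ... + X^(d+1): this is (1 - X) g = 1 - X^(d+1) without subtraction.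
  eval-geometric : ∀ d X → eval (geometric d) X + X ^ suc d ≈ 1# + X * eval (geometric d) X
  eval-geometric zero    X = refl
  eval-geometric (suc d) X = begin
    1# + X * g + X * X ^ suc d    ≈⟨ solve 3 (λ X g y → con 1 :+ X :* g :+ X :* y := con 1 :+ X :* (g :+ y))
                                      refl X g (X ^ suc d) ⟩
    1# + X * (g + X ^ suc d)      ≈⟨ +-congˡ (*-congˡ (eval-geometric d X)) ⟩
    1# + X * (1# + X * g)         ∎
    where g = eval (geometric d) X

  eval-geometric-1 : ∀ d → eval (geometric d) 1# ≈ suc d ×ℕ 1#
  eval-geometric-1 zero    = sym (+-identityʳ 1#)
  eval-geometric-1 (suc d) = +-congˡ (trans (*-identityˡ _) (eval-geometric-1 d))

  geometric-root : ∀ d {ω} → ω ^ suc d ≈ 1# → Unit (1# - ω) → eval (geometric d) ω ≈ 0#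
  geometric-root d {ω} ω^≈1 U = unit-cancel-0 U (begin
    (1# - ω) * g                ≈⟨ *-congʳ (x-y≈x+εy 1# ω) ⟩
    (1# + ε * ω) * g            ≈⟨ solve 3 (λ e w g → (con 1 :+ e :* w) :* g := g :+ e :* (w :* g)) refl ε ω g ⟩
    g + ε * (ω * g)             ≈⟨ x-y≈x+εy g (ω * g) ⟨
    g - ω * g                   ≈⟨ x≈y⇒x∙y⁻¹≈ε g≈ωg ⟩
    0#                          ∎)
    where
    g = eval (geometric d) ω
    open import Algebra.Properties.Ring ring using (+-cancelʳ)
    g≈ωg : g ≈ ω * g
    g≈ωg = +-cancelʳ 1# g (ω * g) (begin
      g + 1#           ≈⟨ +-congˡ ω^≈1 ⟨
      g + ω ^ suc d    ≈⟨ eval-geometric d ω ⟩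
      1# + ω * g       ≈⟨ +-comm 1# _ ⟩
      ω * g + 1#       ∎)

  last-geometric : ∀ d → last (geometric (suc d)) ≈ 1#
  last-geometric zero    = refl
  last-geometric (suc d) = last-geometric d

-- Ring endomorphisms and their iterates

module RingEndomorphism {ℓ₁ ℓ₂} (R : CommutativeRing ℓ₁ ℓ₂)
  (σ : CommutativeRing.Carrier R → CommutativeRing.Carrier R)
  (σ-hom : RingMorphisms.IsRingHomomorphism (CommutativeRing.rawRing R) (CommutativeRing.rawRing R) σ)
  where

  open CommutativeRing R
  open RingMorphisms rawRing rawRing using (IsRingHomomorphism)
  open IsRingHomomorphism σ-hom public
    using (⟦⟧-cong; +-homo; *-homo; 0#-homo; 1#-homo; -‿homo)
  open RingFacts R
  open RangeSum +-commutativeMonoid using (∑<)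
  open RangeSum *-commutativeMonoid using () renaming (∑< to ∏<)

  ∑<-homo : ∀ n f → σ (∑< n f) ≈ ∑< n (σ ∘ f)
  ∑<-homo zero    f = 0#-homo
  ∑<-homo (suc n) f = trans (+-homo _ _) (+-congˡ (∑<-homo n (f ∘ suc)))

  ∏<-homo : ∀ n f → σ (∏< n f) ≈ ∏< n (σ ∘ f)
  ∏<-homo zero    f = 1#-homo
  ∏<-homo (suc n) f = trans (*-homo _ _) (*-congˡ (∏<-homo n (f ∘ suc)))

  ^-homo : ∀ a n → σ (a ^ n) ≈ σ a ^ n
  ^-homo a zero    = 1#-homo
  ^-homo a (suc n) = trans (*-homo _ _) (*-congˡ (^-homo a n))

  unit-homo : ∀ {a} → Unit a → Unit (σ a)
  unit-homo (u , ua≈1) = σ u , trans (sym (*-homo _ _)) (trans (⟦⟧-cong ua≈1) 1#-homo)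

  ε-homo : σ ε ≈ ε
  ε-homo = trans (-‿homo 1#) (-‿cong 1#-homo)

module Iterates {ℓ₁ ℓ₂} (R : CommutativeRing ℓ₁ ℓ₂)
  (σ : CommutativeRing.Carrier R → CommutativeRing.Carrier R)
  (σ-hom : RingMorphisms.IsRingHomomorphism (CommutativeRing.rawRing R) (CommutativeRing.rawRing R) σ)
  where

  open CommutativeRing R
  open RingMorphisms rawRing rawRing using (IsRingHomomorphism)
  open RingEndomorphism R σ σ-hom
  open Endo Carrier using () renaming (_^_ to _^∘_) public

  iterate-isHom : ∀ k → IsRingHomomorphism (σ ^∘ k)
  iterate-isHom zero    = Identity.isRingHomomorphism rawRing refl
  iterate-isHom (suc k) = Composition.isRingHomomorphism trans (iterate-isHom k) σ-hom

  iterate-cong : ∀ k {a b} → a ≈ b → (σ ^∘ k) a ≈ (σ ^∘ k) b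
  iterate-cong k = IsRingHomomorphism.⟦⟧-cong (iterate-isHom k)

  -- The conjugates of ζ, the elements ε^a β and the sequence `w` are all indexed so that σ acts as
  -- the successor; this treats them uniformly.
  iterate-orbit : ∀ (f : ℕ → Carrier) → (∀ a → σ (f a) ≈ f (suc a)) →
                  ∀ k a → (σ ^∘ k) (f a) ≈ f (a ℕ.+ k)
  iterate-orbit f step zero    a = reflexive (≡.cong f (≡.sym (ℕ.+-identityʳ a)))
  iterate-orbit f step (suc k) a = trans (⟦⟧-cong (iterate-orbit f step k a))
    (trans (step (a ℕ.+ k)) (reflexive (≡.cong f (≡.sym (ℕ.+-suc a k)))))

-- Conjugates of ζ, norm, trace and the element β

record CyclotomicEndomorphism {ℓ₁ ℓ₂} (R : CommutativeRing ℓ₁ ℓ₂) (p ρ : ℕ) : Set (ℓ₁ ⊔ ℓ₂) where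
  open CommutativeRing R
  open RingFacts R
  field
    ζ        : Carrier
    ζ^p≈1    : ζ ^ p ≈ 1#
    -- This takes the place of ζ ≠ 1; σ transports it to 1 - ζ^c for every c prime to p.
    1-ζ-unit : Unit (1# - ζ)
    σ        : Carrier → Carrier
    σ-hom    : RingMorphisms.IsRingHomomorphism rawRing rawRing σ
    σζ≈ζ^ρ   : σ ζ ≈ ζ ^ ρ

module GaussianPeriod {ℓ₁ ℓ₂} (R : CommutativeRing ℓ₁ ℓ₂)
  (m : ℕ) .{{_ : NonZero m}} (p : ℕ) .{{_ : NonZero p}}
  (p≡1+2m : p ≡ suc (m ℕ.+ m)) (p-prime : Prime p)
  (ρ : ℕ) (p∤ρ : ¬ p ∣ ρ) (log : ∀ a → ¬ p ∣ a → ∃[ k ] ρ ℕ.^ k % p ≡ a % p)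
  (cyclotomic : CyclotomicEndomorphism R p ρ)
  (l : ℕ) (ρl≈l+1 : (ρ ℕ.* l) % p ≡ (l ℕ.+ 1) % p)
  where

  open CommutativeRing R
  open RingFacts R
  open CyclotomicEndomorphism cyclotomic
  open Residues p
  open PrimitiveRoot m p p≡1+2m p-prime ρ p∤ρ log
  open MonicPolynomial R
  open RangeSum +-commutativeMonoid
  open RangeSum *-commutativeMonoid using () renaming (∑< to ∏<; ∑<-snoc to ∏<-snoc; ∑<-+ to ∏<-+; ∑<-cong to ∏<-cong)
  open RingEndomorphism R σ σ-hom
  open Iterates R σ σ-hom
  open import Algebra.Properties.Semiring.Sum semiring using (*-distribˡ-sum; *-distribʳ-sum)
  open import Algebra.Properties.Ring ring using (+-cancelʳ)
  open import Algebra.Definitions.RawSemiring (Semiring.rawSemiring semiring) using () renaming (_×_ to _×ℕ_)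
  open import Relation.Binary.Reasoning.Setoid setoid

  ε-unit : Unit ε
  ε-unit = ε , ε*ε≈1

  1^≈1 : ∀ k → 1# ^ k ≈ 1#
  1^≈1 zero    = refl
  1^≈1 (suc k) = trans (*-identityˡ _) (1^≈1 k)

  ε^-double : ∀ k → ε ^ (k ℕ.+ k) ≈ 1#
  ε^-double k = begin
    ε ^ (k ℕ.+ k)   ≡⟨ ≡.cong (λ u → ε ^ (k ℕ.+ u)) (ℕ.+-identityʳ k) ⟨
    ε ^ (2 ℕ.* k)   ≈⟨ ^-assocʳ ε 2 k ⟨
    (ε ^ 2) ^ k     ≈⟨ ^-congˡ k (trans (*-congˡ (*-identityʳ ε)) ε*ε≈1) ⟩
    1# ^ k          ≈⟨ 1^≈1 k ⟩
    1#              ∎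

  ζ^-cong : ∀ {a b} → a ≈ₚ b → ζ ^ a ≈ ζ ^ b
  ζ^-cong {a} {b} e = trans (reduce a) (trans (^-congʳ ζ e) (sym (reduce b)))
    where
    reduce : ∀ a → ζ ^ a ≈ ζ ^ (a % p)
    reduce a = begin
      ζ ^ a                                 ≈⟨ ^-congʳ ζ (≡.trans (ℕ.m≡m%n+[m/n]*n a p) (≡.cong (a % p ℕ.+_) (ℕ.*-comm (a / p) p))) ⟩
      ζ ^ (a % p ℕ.+ p ℕ.* (a / p))         ≈⟨ ^-homo-* ζ (a % p) (p ℕ.* (a / p)) ⟩
      ζ ^ (a % p) * ζ ^ (p ℕ.* (a / p))     ≈⟨ *-congˡ (^-assocʳ ζ p (a / p)) ⟨
      ζ ^ (a % p) * (ζ ^ p) ^ (a / p)       ≈⟨ *-congˡ (trans (^-congˡ (a / p) ζ^p≈1) (1^≈1 (a / p))) ⟩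
      ζ ^ (a % p) * 1#                      ≈⟨ *-identityʳ _ ⟩
      ζ ^ (a % p)                           ∎

  ζ^-∣ : ∀ {a} → p ∣ a → ζ ^ a ≈ 1#
  ζ^-∣ {a} d = ζ^-cong {a} {0} (∣⇒≈0 d)

  ζ^^p : ∀ a → (ζ ^ a) ^ p ≈ 1#
  ζ^^p a = trans (^-assocʳ ζ a p) (ζ^-∣ (ℕ.n∣m*n a))

  σζ^ : ∀ a → σ (ζ ^ a) ≈ ζ ^ (ρ ℕ.* a)
  σζ^ a = trans (^-homo ζ a) (trans (^-congˡ a σζ≈ζ^ρ) (^-assocʳ ζ ρ a))

  σ^ζ^ : ∀ k c → (σ ^∘ k) (ζ ^ c) ≈ ζ ^ (ρ ℕ.^ k ℕ.* c)
  σ^ζ^ k c = trans (iterate-cong k (^-congʳ ζ (≡.sym (ℕ.*-identityˡ c))))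
    (iterate-orbit (λ a → ζ ^ (ρ ℕ.^ a ℕ.* c))
    (λ a → trans (σζ^ (ρ ℕ.^ a ℕ.* c)) (^-congʳ ζ (≡.sym (ℕ.*-assoc ρ (ρ ℕ.^ a) c)))) k 0)

  ζ^-unit : ∀ a → Unit (ζ ^ a)
  ζ^-unit a = (ζ ^ a) ^ ℕ.pred p ,
    trans (*-comm _ _) (trans (reflexive (≡.cong ((ζ ^ a) ^_) (ℕ.suc-pred p))) (ζ^^p a))

  σ-1- : ∀ y → σ (1# - y) ≈ 1# - σ y
  σ-1- y = trans (+-homo 1# (- y)) (+-cong 1#-homo (-‿homo y))

  -- Modulo p, c is some power ρ^k, so 1 - ζ^c is the image of 1 - ζ under σ^k, and homomorphisms
  -- preserve units.
  1-ζ^-unit : ∀ {c} → ¬ p ∣ c → Unit (1# - ζ ^ c)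
  1-ζ^-unit {c} p∤c =
    let k , e = log c p∤c
    in unit-resp (+-congˡ (-‿cong (ζ^-cong {ρ ℕ.^ k} {c} e))) (unit-pow k)
    where
    unit-pow : ∀ k → Unit (1# - ζ ^ (ρ ℕ.^ k))
    unit-pow zero    = unit-resp (+-congˡ (-‿cong (sym (*-identityʳ ζ)))) 1-ζ-unit
    unit-pow (suc k) = unit-resp (trans (σ-1- _) (+-congˡ (-‿cong (σζ^ (ρ ℕ.^ k))))) (unit-homo (unit-pow k))

  conjugate : ℕ → Carrier
  conjugate j = ζ ^ (ρ ℕ.^ j)

  conjugate-inverse : ∀ j → conjugate j * conjugate (m ℕ.+ j) ≈ 1#
  conjugate-inverse j = trans (sym (^-homo-* ζ (ρ ℕ.^ j) _)) (ζ^-∣ (∣-sum j))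

  -- With `conjugate (m + j)` as the inverse of ζj, the difference is -ζj (1 - ζi / ζj), a product
  -- of three units.
  conjugates-apart : ∀ {i j} → i ℕ.< m ℕ.+ m → j ℕ.< m ℕ.+ m → i ≢ j → Unit (conjugate i - conjugate j)
  conjugates-apart {i} {j} i< j< i≢j = unit-resp (begin
    ε * (ζj * (1# - ζ ^ (ρ ℕ.^ i ℕ.+ ρ ℕ.^ (m ℕ.+ j))))      ≈⟨ *-congˡ (*-congˡ (+-congˡ (-‿cong (^-homo-* ζ (ρ ℕ.^ i) _)))) ⟩
    ε * (ζj * (1# - ζi * ζj′))          ≈⟨ *-congˡ (*-congˡ (x-y≈x+εy 1# _)) ⟩
    ε * (ζj * (1# + ε * (ζi * ζj′)))    ≈⟨ solve 4 (λ e x y y′ → e :* (y :* (con 1 :+ e :* (x :* y′)))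
                                             := e :* e :* (y :* y′) :* x :+ e :* y) refl ε ζi ζj ζj′ ⟩
    ε * ε * (ζj * ζj′) * ζi + ε * ζj    ≈⟨ +-congʳ (*-congʳ (trans (*-cong ε*ε≈1 (conjugate-inverse j)) (*-identityˡ 1#))) ⟩
    1# * ζi + ε * ζj                    ≈⟨ +-congʳ (*-identityˡ ζi) ⟩
    ζi + ε * ζj                         ≈⟨ x-y≈x+εy ζi ζj ⟨
    ζi - ζj                             ∎)
    (unit-* ε-unit (unit-* (ζ^-unit (ρ ℕ.^ j)) (1-ζ^-unit (∤-sum i< j< i≢j))))
    where
    ζi  = conjugate i
    ζj  = conjugate j
    ζj′ = conjugate (m ℕ.+ j)

  conjugate-root : ∀ j → eval (geometric (m ℕ.+ m)) (conjugate j) ≈ 0#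
  conjugate-root j = geometric-root (m ℕ.+ m)
    (trans (^-congʳ (conjugate j) (≡.sym p≡1+2m)) (ζ^^p (ρ ℕ.^ j))) (1-ζ^-unit (p∤^ j))

  P : Carrier
  P = p ×ℕ 1#

  P≈ : P ≈ suc (m ℕ.+ m) ×ℕ 1#
  P≈ = reflexive (≡.cong (_×ℕ 1#) p≡1+2m)

  -- Evaluate both forms of 1 + X + ... + X^(p-1) at X = 1.
  norm : ∏< (m ℕ.+ m) (λ j → 1# - conjugate j) ≈ P
  norm = begin
    ∏< (m ℕ.+ m) (λ j → 1# - conjugate j)   ≈⟨ factorisation (geometric (m ℕ.+ m)) conjugate (λ {i} _ → conjugate-root i)
                                                 (λ i<j j< → conjugates-apart j< (ℕ.<-trans i<j j<) (ℕ.>⇒≢ i<j)) 1# ⟨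
    eval (geometric (m ℕ.+ m)) 1#           ≈⟨ eval-geometric-1 (m ℕ.+ m) ⟩
    suc (m ℕ.+ m) ×ℕ 1#                     ≈⟨ P≈ ⟨
    P                                       ∎

  trace : ∑< (m ℕ.+ m) conjugate ≈ ε
  trace = +-cancelʳ 1# _ _ (trans (sum+1 (m ℕ.+ m) (ℕ.<-≤-trans (ℕ.>-nonZero⁻¹ m) (ℕ.m≤m+n m m)) conjugate-root
      (λ i<j j< → conjugates-apart j< (ℕ.<-trans i<j j<) (ℕ.>⇒≢ i<j))) (sym ε+1≈0))
    where
    -- The degree is generalised because `vieta` wants a successor, which m + m is not by
    -- computation; the 1 is the subleading coefficient.
    sum+1 : ∀ d → 0 ℕ.< d → (∀ j → eval (geometric d) (conjugate j) ≈ 0#) →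
      (∀ {i j} → i ℕ.< j → j ℕ.< d → Unit (conjugate j - conjugate i)) → ∑< d conjugate + 1# ≈ 0#
    sum+1 (suc d) _ root sep = trans (+-congˡ (sym (last-geometric d)))
      (vieta (geometric (suc d)) conjugate (λ {i} _ → root i) sep)

  conjugate-period : ∀ a → conjugate (a ℕ.+ (m ℕ.+ m)) ≈ conjugate a
  conjugate-period a = ζ^-cong {ρ ℕ.^ (a ℕ.+ (m ℕ.+ m))} {ρ ℕ.^ a} (≡.trans (≡.cong (_% p) (ℕ.^-distribˡ-+-* ρ a (m ℕ.+ m)))
    (≡.trans (*-congₚ {ρ ℕ.^ a} {ρ ℕ.^ a} {ρ ℕ.^ (m ℕ.+ m)} {1} ≡.refl fermat) (≡.cong (_% p) (ℕ.*-identityʳ (ρ ℕ.^ a)))))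

  -- Replacing c by a power ρ^k shifts the index of the conjugates by k, and a full period is
  -- insensitive to shifts.
  character-sum : ∀ {c} → ¬ p ∣ c → ∑< (m ℕ.+ m) (λ a → ζ ^ (c ℕ.* ρ ℕ.^ a)) ≈ ε
  character-sum {c} p∤c =
    let k , e = log c p∤c
        pow a = ≡.trans (*-congₚ {c} {ρ ℕ.^ k} {ρ ℕ.^ a} {ρ ℕ.^ a} (≡.sym e) ≡.refl)
          (≡.cong (_% p) (≡.trans (ℕ.*-comm (ρ ℕ.^ k) (ρ ℕ.^ a)) (≡.sym (ℕ.^-distribˡ-+-* ρ a k))))
    in begin
      ∑< (m ℕ.+ m) (λ a → ζ ^ (c ℕ.* ρ ℕ.^ a))    ≈⟨ ∑<-cong (m ℕ.+ m) (λ a → ζ^-cong {c ℕ.* ρ ℕ.^ a} {ρ ℕ.^ (a ℕ.+ k)} (pow a)) ⟩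
      ∑< (m ℕ.+ m) (λ a → conjugate (a ℕ.+ k))    ≈⟨ ∑<-shift (m ℕ.+ m) conjugate conjugate-period k ⟩
      ∑< (m ℕ.+ m) conjugate                      ≈⟨ trace ⟩
      ε                                           ∎

  α : Carrier
  α = ∏< m (λ j → 1# - conjugate j)

  -- By `ε^mβ²` its square is (-1)^m p, which is also the square of the quadratic Gauss sum.
  β : Carrier
  β = ζ ^ l * α

  σ^-conjugate : ∀ k j → (σ ^∘ k) (conjugate j) ≈ conjugate (j ℕ.+ k)
  σ^-conjugate k j = iterate-orbit conjugate (λ a → σζ^ (ρ ℕ.^ a)) k j

  module _ (k : ℕ) where
    private module σ^ = RingEndomorphism R (σ ^∘ k) (iterate-isHom k)

    σ^α : (σ ^∘ k) α ≈ ∏< m (λ j → 1# - conjugate (j ℕ.+ k))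
    σ^α = trans (σ^.∏<-homo m (λ j → 1# - conjugate j)) (∏<-cong m λ j →
      trans (σ^.+-homo 1# _) (+-cong σ^.1#-homo (trans (σ^.-‿homo _) (-‿cong (σ^-conjugate k j)))))

  ζζm≈1 : ζ * conjugate m ≈ 1#
  ζζm≈1 = trans (*-cong (sym (*-identityʳ ζ)) (reflexive (≡.cong conjugate (≡.sym (ℕ.+-identityʳ m))))) (conjugate-inverse 0)

  -- σ moves every factor of α one place on, so (1 - ζ) σ(α) = α (1 - ζ⁻¹), and 1 - ζ⁻¹ = -ζ⁻¹ (1 -
  -- ζ). The unit 1 - ζ cancels.
  σα : σ α ≈ α * (ε * conjugate m)
  σα = unit-cancelˡ 1-ζ-unit (begin
    (1# - ζ) * σ α                                       ≈⟨ *-cong (+-congˡ (-‿cong (sym (*-identityʳ ζ)))) (trans (σ^α 1)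
                                                            (∏<-cong m λ j → +-congˡ (-‿cong (reflexive (≡.cong conjugate (ℕ.+-comm j 1)))))) ⟩
    ∏< (suc m) (λ j → 1# - conjugate j)                  ≈⟨ ∏<-snoc m (λ j → 1# - conjugate j) ⟩
    α * (1# - conjugate m)                               ≈⟨ *-congˡ (x-y≈x+εy 1# _) ⟩
    α * (1# + ε * conjugate m)                           ≈⟨ *-congˡ (+-congʳ (trans (*-cong ε*ε≈1 ζζm≈1) (*-identityˡ 1#))) ⟨
    α * (ε * ε * (ζ * conjugate m) + ε * conjugate m)    ≈⟨ solve 4 (λ a e z z′ → a :* (e :* e :* (z :* z′) :+ e :* z′)
                                                             := (con 1 :+ e :* z) :* (a :* (e :* z′))) refl α ε ζ (conjugate m) ⟩
    (1# + ε * ζ) * (α * (ε * conjugate m))               ≈⟨ *-congʳ (x-y≈x+εy 1# ζ) ⟨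
    (1# - ζ) * (α * (ε * conjugate m))                   ∎)

  -- This is what λ is chosen for: the extra ζ in σ(ζ^λ) cancels the ζ⁻¹ in σ(α) and leaves only the
  -- sign.
  σβ : σ β ≈ ε * β
  σβ = begin
    σ (ζ ^ l * α)                               ≈⟨ *-homo _ _ ⟩
    σ (ζ ^ l) * σ α                             ≈⟨ *-cong (trans (σζ^ l) (ζ^-cong {ρ ℕ.* l} {l ℕ.+ 1} ρl≈l+1)) σα ⟩
    ζ ^ (l ℕ.+ 1) * (α * (ε * conjugate m))     ≈⟨ *-congʳ (trans (^-homo-* ζ l 1) (*-congˡ (*-identityʳ ζ))) ⟩
    ζ ^ l * ζ * (α * (ε * conjugate m))         ≈⟨ solve 5 (λ y z a e z′ → y :* z :* (a :* (e :* z′)) := e :* (y :* a) :* (z :* z′))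
                                                    refl (ζ ^ l) ζ α ε (conjugate m) ⟩
    ε * β * (ζ * conjugate m)                   ≈⟨ *-congˡ ζζm≈1 ⟩
    ε * β * 1#                                  ≈⟨ *-identityʳ _ ⟩
    ε * β                                       ∎

  σ^β : ∀ k → (σ ^∘ k) β ≈ ε ^ k * β
  σ^β k = trans (iterate-cong k (sym (*-identityˡ β))) (iterate-orbit (λ a → ε ^ a * β) (λ a → begin
    σ (ε ^ a * β)           ≈⟨ *-homo _ _ ⟩
    σ (ε ^ a) * σ β         ≈⟨ *-cong (trans (^-homo ε a) (^-congˡ a ε-homo)) σβ ⟩
    ε ^ a * (ε * β)         ≈⟨ solve 3 (λ x e b → x :* (e :* b) := e :* x :* b) refl (ε ^ a) ε β ⟩
    ε * ε ^ a * β           ∎) k 0)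

  α*σ^mα : α * (σ ^∘ m) α ≈ P
  α*σ^mα = begin
    α * (σ ^∘ m) α                               ≈⟨ *-congˡ (trans (σ^α m) (∏<-cong m λ j → +-congˡ (-‿cong (reflexive (≡.cong conjugate (ℕ.+-comm j m)))))) ⟩
    α * ∏< m (λ j → 1# - conjugate (m ℕ.+ j))    ≈⟨ ∏<-+ m m (λ j → 1# - conjugate j) ⟨
    ∏< (m ℕ.+ m) (λ j → 1# - conjugate j)        ≈⟨ norm ⟩
    P                                            ∎

  -- β σ^m(β) is evaluated twice: by `σ^β`, and factor by factor, where the powers of ζ cancel since
  -- ρ^m = -1 and the rest is the norm of 1 - ζ.
  ε^mβ² : ε ^ m * (β * β) ≈ P
  ε^mβ² = begin
    ε ^ m * (β * β)                                       ≈⟨ solve 2 (λ x b → x :* (b :* b) := b :* (x :* b)) refl (ε ^ m) β ⟩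
    β * (ε ^ m * β)                                       ≈⟨ *-congˡ (σ^β m) ⟨
    β * (σ ^∘ m) β                                        ≈⟨ *-congˡ (trans (σ^.*-homo _ _) (*-congʳ (σ^ζ^ m l))) ⟩
    ζ ^ l * α * (ζ ^ (ρ ℕ.^ m ℕ.* l) * (σ ^∘ m) α)        ≈⟨ solve 4 (λ x a y b → x :* a :* (y :* b) := x :* y :* (a :* b)) refl
                                                             (ζ ^ l) α (ζ ^ (ρ ℕ.^ m ℕ.* l)) ((σ ^∘ m) α) ⟩
    ζ ^ l * ζ ^ (ρ ℕ.^ m ℕ.* l) * (α * (σ ^∘ m) α)        ≈⟨ *-cong (trans (sym (^-homo-* ζ l _)) (ζ^-∣ (ℕ.∣m⇒∣m*n l half))) α*σ^mα ⟩
    1# * P                                                ≈⟨ *-identityˡ P ⟩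
    P                                                     ∎
    where module σ^ = RingEndomorphism R (σ ^∘ m) (iterate-isHom m)

  -- The orbit under σ of w 0 = -β ζ, the part of z = β - β ζ that survives in the trace.
  w : ℕ → Carrier
  w a = ε * (β * (ε ^ a * conjugate a))

  w-period : ∀ a → w (a ℕ.+ (m ℕ.+ m)) ≈ w a
  w-period a = *-congˡ (*-congˡ (*-cong
    (trans (^-homo-* ε a (m ℕ.+ m)) (trans (*-congˡ (ε^-double m)) (*-identityʳ _))) (conjugate-period a)))

  σw : ∀ a → σ (w a) ≈ w (suc a)
  σw a = begin
    σ (ε * (β * (ε ^ a * conjugate a)))                ≈⟨ trans (*-homo _ _) (*-congˡ (trans (*-homo _ _) (*-congˡ (*-homo _ _)))) ⟩
    σ ε * (σ β * (σ (ε ^ a) * σ (conjugate a)))        ≈⟨ *-cong ε-homo (*-cong σβ (*-cong (trans (^-homo ε a) (^-congˡ a ε-homo)) (σζ^ (ρ ℕ.^ a)))) ⟩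
    ε * (ε * β * (ε ^ a * conjugate (suc a)))          ≈⟨ solve 4 (λ e b x z → e :* (e :* b :* (x :* z)) := e :* (b :* (e :* x :* z)))
                                                          refl ε β (ε ^ a) (conjugate (suc a)) ⟩
    w (suc a)                                          ∎

  z : Carrier
  z = β * (1# - ζ)

  σ^z : ∀ k → (σ ^∘ k) z ≈ ε ^ k * β + w k
  σ^z k = begin
    (σ ^∘ k) z                         ≈⟨ iterate-cong k z≈β+w0 ⟩
    (σ ^∘ k) (β + w 0)                 ≈⟨ σ^.+-homo β (w 0) ⟩
    (σ ^∘ k) β + (σ ^∘ k) (w 0)        ≈⟨ +-cong (σ^β k) (iterate-orbit w σw k 0) ⟩
    ε ^ k * β + w k                    ∎
    where
    module σ^ = RingEndomorphism R (σ ^∘ k) (iterate-isHom k)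
    z≈β+w0 : z ≈ β + w 0
    z≈β+w0 = trans (*-congˡ (x-y≈x+εy 1# ζ))
      (solve 3 (λ b e z → b :* (con 1 :+ e :* z) := b :+ e :* (b :* (con 1 :* (z :* con 1)))) refl β ε ζ)

  δ : ℕ → ℕ → Carrier
  δ i j = if does (i ℕ.≟ j) then 1# else 0#

  δ-≡ : ∀ {i j} → i ≡ j → δ i j ≈ 1#
  δ-≡ {i} {j} e rewrite dec-true (i ℕ.≟ j) e = refl

  δ-≢ : ∀ {i j} → i ≢ j → δ i j ≈ 0#
  δ-≢ {i} {j} e rewrite dec-false (i ℕ.≟ j) e = refl

  -- In each term the two factors β give β², whose sign ε^m is absorbed by the shift by m. What
  -- remains is the sum of ζ^(c ρ^a) with c equal to ρ^i - ρ^b modulo p: p - 1 if i = b, and -1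
  -- otherwise.
  correlation : ∀ {i b} → i ℕ.< m ℕ.+ m → b ℕ.< m ℕ.+ m →
    ∑< (m ℕ.+ m) (λ a → w (a ℕ.+ i) * w (a ℕ.+ (m ℕ.+ b))) ≈ P * (ε ^ (i ℕ.+ b) * ε + P * δ i b)
  correlation {i} {b} i< b< = begin
    ∑< (m ℕ.+ m) (λ a → w (a ℕ.+ i) * w (a ℕ.+ (m ℕ.+ b)))         ≈⟨ ∑<-cong (m ℕ.+ m) term ⟩
    ∑< (m ℕ.+ m) (λ a → P * ε ^ (i ℕ.+ b) * ζ ^ (c ℕ.* ρ ℕ.^ a))   ≈⟨ *-distribˡ-sum {m ℕ.+ m} (P * ε ^ (i ℕ.+ b)) _ ⟨
    P * ε ^ (i ℕ.+ b) * ∑< (m ℕ.+ m) (λ a → ζ ^ (c ℕ.* ρ ℕ.^ a))   ≈⟨ *-assoc _ _ _ ⟩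
    P * (ε ^ (i ℕ.+ b) * ∑< (m ℕ.+ m) (λ a → ζ ^ (c ℕ.* ρ ℕ.^ a))) ≈⟨ *-congˡ total ⟩
    P * (ε ^ (i ℕ.+ b) * ε + P * δ i b)                            ∎
    where
    c = ρ ℕ.^ i ℕ.+ ρ ℕ.^ (m ℕ.+ b)

    exponents : ∀ a → ρ ℕ.^ (a ℕ.+ i) ℕ.+ ρ ℕ.^ (a ℕ.+ (m ℕ.+ b)) ≡ c ℕ.* ρ ℕ.^ a
    exponents a = ≡.trans (≡.cong₂ ℕ._+_ (ℕ.^-distribˡ-+-* ρ a i) (ℕ.^-distribˡ-+-* ρ a (m ℕ.+ b)))
      (≡.trans (≡.sym (ℕ.*-distribˡ-+ (ρ ℕ.^ a) (ρ ℕ.^ i) (ρ ℕ.^ (m ℕ.+ b)))) (ℕ.*-comm (ρ ℕ.^ a) c))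

    signs : ∀ a → (a ℕ.+ i) ℕ.+ (a ℕ.+ (m ℕ.+ b)) ≡ (a ℕ.+ a) ℕ.+ (m ℕ.+ (i ℕ.+ b))
    signs a = signs′ a i m b where
      signs′ : ∀ a i m b → (a ℕ.+ i) ℕ.+ (a ℕ.+ (m ℕ.+ b)) ≡ (a ℕ.+ a) ℕ.+ (m ℕ.+ (i ℕ.+ b))
      signs′ = solve-∀

    term : ∀ a → w (a ℕ.+ i) * w (a ℕ.+ (m ℕ.+ b)) ≈ P * ε ^ (i ℕ.+ b) * ζ ^ (c ℕ.* ρ ℕ.^ a)
    term a = begin
      w (a ℕ.+ i) * w (a ℕ.+ (m ℕ.+ b))
        ≈⟨ solve 6 (λ e b x y u v → e :* (b :* (x :* u)) :* (e :* (b :* (y :* v))) := e :* e :* (x :* y :* (b :* b)) :* (u :* v))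
            refl ε β (ε ^ (a ℕ.+ i)) (ε ^ (a ℕ.+ (m ℕ.+ b))) (conjugate (a ℕ.+ i)) (conjugate (a ℕ.+ (m ℕ.+ b))) ⟩
      ε * ε * (ε ^ (a ℕ.+ i) * ε ^ (a ℕ.+ (m ℕ.+ b)) * (β * β)) * (conjugate (a ℕ.+ i) * conjugate (a ℕ.+ (m ℕ.+ b)))
        ≈⟨ *-cong (*-cong ε*ε≈1 (*-congʳ (trans (sym (^-homo-* ε (a ℕ.+ i) _)) (trans (^-congʳ ε (signs a))
             (trans (^-homo-* ε (a ℕ.+ a) _) (*-cong (ε^-double a) (^-homo-* ε m (i ℕ.+ b))))))))
             (trans (sym (^-homo-* ζ (ρ ℕ.^ (a ℕ.+ i)) _)) (^-congʳ ζ (exponents a))) ⟩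
      1# * (1# * (ε ^ m * ε ^ (i ℕ.+ b)) * (β * β)) * ζ ^ (c ℕ.* ρ ℕ.^ a)
        ≈⟨ *-congʳ (solve 3 (λ x y b → con 1 :* (con 1 :* (x :* y) :* b) := x :* b :* y) refl (ε ^ m) (ε ^ (i ℕ.+ b)) (β * β)) ⟩
      ε ^ m * (β * β) * ε ^ (i ℕ.+ b) * ζ ^ (c ℕ.* ρ ℕ.^ a)
        ≈⟨ *-congʳ (*-congʳ ε^mβ²) ⟩
      P * ε ^ (i ℕ.+ b) * ζ ^ (c ℕ.* ρ ℕ.^ a)  ∎

    ∑<-1 : ∀ k → ∑< k (λ _ → 1#) ≈ k ×ℕ 1#
    ∑<-1 zero    = refl
    ∑<-1 (suc k) = +-congˡ (∑<-1 k)

    total : ε ^ (i ℕ.+ b) * ∑< (m ℕ.+ m) (λ a → ζ ^ (c ℕ.* ρ ℕ.^ a)) ≈ ε ^ (i ℕ.+ b) * ε + P * δ i b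
    total with i ℕ.≟ b
    -- All 2m terms are 1. Inserting ε + 1 = 0 rewrites 2m as ε + p, which matches the shape of the
    -- off-diagonal case.
    ... | yes ≡.refl = begin
      ε ^ (i ℕ.+ i) * ∑< (m ℕ.+ m) (λ a → ζ ^ (c ℕ.* ρ ℕ.^ a))   ≈⟨ *-cong (ε^-double i) (∑<-cong (m ℕ.+ m) λ a →
                                                                     ζ^-∣ (ℕ.∣m⇒∣m*n (ρ ℕ.^ a) (∣-sum i))) ⟩
      1# * ∑< (m ℕ.+ m) (λ _ → 1#)                               ≈⟨ *-congˡ (∑<-1 (m ℕ.+ m)) ⟩
      1# * ((m ℕ.+ m) ×ℕ 1#)                                     ≈⟨ +-identityˡ _ ⟨
      0# + 1# * ((m ℕ.+ m) ×ℕ 1#)                                ≈⟨ +-congʳ ε+1≈0 ⟨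
      ε + 1# + 1# * ((m ℕ.+ m) ×ℕ 1#)                            ≈⟨ solve 2 (λ e k → e :+ con 1 :+ con 1 :* k := con 1 :* e :+ (con 1 :+ k) :* con 1)
                                                                     refl ε ((m ℕ.+ m) ×ℕ 1#) ⟩
      1# * ε + (suc (m ℕ.+ m) ×ℕ 1#) * 1#                        ≈⟨ +-cong (*-congʳ (ε^-double i)) (*-cong P≈ (δ-≡ {i} ≡.refl)) ⟨
      ε ^ (i ℕ.+ i) * ε + P * δ i i                              ∎
    ... | no i≢b = begin
      ε ^ (i ℕ.+ b) * ∑< (m ℕ.+ m) (λ a → ζ ^ (c ℕ.* ρ ℕ.^ a))   ≈⟨ *-congˡ (character-sum (∤-sum i< b< i≢b)) ⟩
      ε ^ (i ℕ.+ b) * ε                                          ≈⟨ +-identityʳ _ ⟨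
      ε ^ (i ℕ.+ b) * ε + 0#                                     ≈⟨ +-congˡ (trans (*-congˡ (δ-≢ i≢b)) (zeroʳ P)) ⟨
      ε ^ (i ℕ.+ b) * ε + P * δ i b                              ∎

  -- The trace x, its conjugates and the row relations

  module Trace (n d h q : ℕ) .{{_ : NonZero d}} (n≡1+2q : n ≡ suc (q ℕ.+ q)) (d≡2h : d ≡ h ℕ.+ h)
    (d*n≡2m : d ℕ.* n ≡ m ℕ.+ m) (h*n≡m : h ℕ.* n ≡ m) where

    x : Carrier
    x = ∑< d (λ j → (σ ^∘ (suc j ℕ.* n)) z)

    period : ∀ c j → w ((j ℕ.+ d) ℕ.* n ℕ.+ c) ≈ w (j ℕ.* n ℕ.+ c)
    period c j = trans (reflexive (≡.cong w (≡.trans (lem j d n c) (≡.cong (j ℕ.* n ℕ.+ c ℕ.+_) d*n≡2m)))) (w-period (j ℕ.* n ℕ.+ c))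
      where
      lem : ∀ j d n c → (j ℕ.+ d) ℕ.* n ℕ.+ c ≡ j ℕ.* n ℕ.+ c ℕ.+ d ℕ.* n
      lem = solve-∀

    shift : ∀ c k → ∑< d (λ j → w ((j ℕ.+ k) ℕ.* n ℕ.+ c)) ≈ ∑< d (λ j → w (j ℕ.* n ℕ.+ c))
    shift c k = ∑<-shift d (λ j → w (j ℕ.* n ℕ.+ c)) (period c) k

    ε^-n : ∀ j → ε ^ (j ℕ.* n) ≈ ε ^ j
    ε^-n j = begin
      ε ^ (j ℕ.* n)                             ≡⟨ ≡.cong (ε ^_) (≡.trans (≡.cong (j ℕ.*_) n≡1+2q) (lem j q)) ⟩
      ε ^ (j ℕ.+ (j ℕ.* q ℕ.+ j ℕ.* q))         ≈⟨ ^-homo-* ε j _ ⟩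
      ε ^ j * ε ^ (j ℕ.* q ℕ.+ j ℕ.* q)         ≈⟨ *-congˡ (ε^-double (j ℕ.* q)) ⟩
      ε ^ j * 1#                                ≈⟨ *-identityʳ _ ⟩
      ε ^ j                                     ∎
      where
      lem : ∀ j q → j ℕ.* suc (q ℕ.+ q) ≡ j ℕ.+ (j ℕ.* q ℕ.+ j ℕ.* q)
      lem = solve-∀

    alternating : ∀ h → ∑< (h ℕ.+ h) (ε ^_) ≈ 0#
    alternating zero    = refl
    alternating (suc h) = begin
      ∑< (suc h ℕ.+ suc h) (ε ^_)                            ≡⟨ ≡.cong (λ k → ∑< (suc k) (ε ^_)) (ℕ.+-suc h h) ⟩
      1# + (ε * 1# + ∑< (h ℕ.+ h) (λ j → ε * (ε * ε ^ j)))   ≈⟨ +-congˡ (+-congˡ (∑<-cong (h ℕ.+ h) {λ j → ε * (ε * ε ^ j)} {ε ^_} λ j →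
                                                                trans (sym (*-assoc ε ε _)) (trans (*-congʳ ε*ε≈1) (*-identityˡ _)))) ⟩
      1# + (ε * 1# + ∑< (h ℕ.+ h) (ε ^_))                    ≈⟨ +-congˡ (+-congˡ (alternating h)) ⟩
      1# + (ε * 1# + 0#)                                     ≈⟨ solve 1 (λ e → con 1 :+ (e :* con 1 :+ con 0) := e :+ con 1) refl ε ⟩
      ε + 1#                                                 ≈⟨ ε+1≈0 ⟩
      0#                                                     ∎

    alternating-d : ∑< d (λ j → ε ^ (j ℕ.* n)) ≈ 0#
    alternating-d = trans (∑<-cong d ε^-n) (trans (reflexive (≡.cong (λ k → ∑< k (ε ^_)) d≡2h)) (alternating h))

    x≈ : x ≈ ∑< d (λ j → w (j ℕ.* n))
    x≈ = begin
      ∑< d (λ j → (σ ^∘ (suc j ℕ.* n)) z)                                    ≈⟨ ∑<-cong d (λ j → σ^z (suc j ℕ.* n)) ⟩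
      ∑< d (λ j → ε ^ (suc j ℕ.* n) * β + w (suc j ℕ.* n))                   ≈⟨ ∑-distrib-+ {d} _ _ ⟩
      -- The trace runs over j = 1, ..., d; as d n is a period of `w`, rotation brings the range to
      -- 0, ..., d - 1.
      ∑< d (λ j → ε ^ (suc j ℕ.* n) * β) + ∑< d (λ j → w (suc j ℕ.* n))      ≈⟨ +-cong signs (∑<-rotate d (λ j → w (j ℕ.* n))
                                                                                 (trans (reflexive (≡.cong w d*n≡2m)) (w-period 0))) ⟩
      0# + ∑< d (λ j → w (j ℕ.* n))                                          ≈⟨ +-identityˡ _ ⟩
      ∑< d (λ j → w (j ℕ.* n))                                               ∎
      where
      signs : ∑< d (λ j → ε ^ (suc j ℕ.* n) * β) ≈ 0#
      signs = begin
        ∑< d (λ j → ε ^ (suc j ℕ.* n) * β)         ≈⟨ ∑<-cong d (λ j → trans (*-congʳ (^-homo-* ε n (j ℕ.* n)))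
                                                      (solve 3 (λ x y b → x :* y :* b := x :* b :* y) refl (ε ^ n) (ε ^ (j ℕ.* n)) β)) ⟩
        ∑< d (λ j → ε ^ n * β * ε ^ (j ℕ.* n))     ≈⟨ *-distribˡ-sum {d} (ε ^ n * β) _ ⟨
        ε ^ n * β * ∑< d (λ j → ε ^ (j ℕ.* n))     ≈⟨ *-congˡ alternating-d ⟩
        ε ^ n * β * 0#                             ≈⟨ zeroʳ _ ⟩
        0#                                         ∎

    σ^x : ∀ k → (σ ^∘ k) x ≈ ∑< d (λ j → w (j ℕ.* n ℕ.+ k))
    σ^x k = begin
      (σ ^∘ k) x                                 ≈⟨ iterate-cong k x≈ ⟩
      (σ ^∘ k) (∑< d (λ j → w (j ℕ.* n)))        ≈⟨ σ^.∑<-homo d (λ j → w (j ℕ.* n)) ⟩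
      ∑< d (λ j → (σ ^∘ k) (w (j ℕ.* n)))        ≈⟨ ∑<-cong d (λ j → iterate-orbit w σw k (j ℕ.* n)) ⟩
      ∑< d (λ j → w (j ℕ.* n ℕ.+ k))             ∎
      where module σ^ = RingEndomorphism R (σ ^∘ k) (iterate-isHom k)

    σ^x-shift : ∀ s k → (σ ^∘ (s ℕ.* n ℕ.+ k)) x ≈ (σ ^∘ k) x
    σ^x-shift s k = begin
      (σ ^∘ (s ℕ.* n ℕ.+ k)) x                         ≈⟨ σ^x (s ℕ.* n ℕ.+ k) ⟩
      ∑< d (λ j → w (j ℕ.* n ℕ.+ (s ℕ.* n ℕ.+ k)))     ≈⟨ ∑<-cong d (λ j → reflexive (≡.cong w (lem j n s k))) ⟩
      ∑< d (λ j → w ((j ℕ.+ s) ℕ.* n ℕ.+ k))           ≈⟨ shift k s ⟩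
      ∑< d (λ j → w (j ℕ.* n ℕ.+ k))                   ≈⟨ σ^x k ⟨
      (σ ^∘ k) x                                       ∎
      where
      lem : ∀ j n s k → j ℕ.* n ℕ.+ (s ℕ.* n ℕ.+ k) ≡ (j ℕ.+ s) ℕ.* n ℕ.+ k
      lem = solve-∀

    σⁿx≈x : (σ ^∘ n) x ≈ x
    σⁿx≈x = trans (reflexive (≡.cong (λ k → (σ ^∘ k) x) (lem n))) (σ^x-shift 1 0)
      where
      lem : ∀ n → n ≡ 1 ℕ.* n ℕ.+ 0
      lem = solve-∀

    -- m is the multiple h n of n. This serves twice: it makes the conjugates of x real, and it
    -- permits the shift by m in `orthogonality`.
    σ^m-fixes : ∀ k → (σ ^∘ (m ℕ.+ k)) x ≈ (σ ^∘ k) x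
    σ^m-fixes k = trans (reflexive (≡.cong (λ u → (σ ^∘ (u ℕ.+ k)) x) (≡.sym h*n≡m))) (σ^x-shift h k)

    -- The product of two traces is a sum over j and b. Shifting the second index by j makes both
    -- factors depend on a = j n + k, which runs through all of 0, ..., 2m - 1 as j and k vary; the
    -- sum over a is a correlation for each fixed b.
    orthogonality : ∀ {i i′} → i ℕ.< n → i′ ℕ.< n →
      ∑< n (λ k → (σ ^∘ (i ℕ.+ k)) x * (σ ^∘ (i′ ℕ.+ k)) x) ≈ P * (P * δ i i′)
    orthogonality {i} {i′} i<n i′<n = begin
      ∑< n (λ k → (σ ^∘ (i ℕ.+ k)) x * (σ ^∘ (i′ ℕ.+ k)) x)                  ≈⟨ ∑<-cong n expand ⟩
      ∑< n (λ k → ∑< d (λ j → F (j ℕ.* n ℕ.+ k)))                            ≈⟨ ∑<-comm n d (λ k j → F (j ℕ.* n ℕ.+ k)) ⟩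
      ∑< d (λ j → ∑< n (λ k → F (j ℕ.* n ℕ.+ k)))                            ≈⟨ ∑<-* d n F ⟨
      ∑< (d ℕ.* n) F                                                         ≡⟨ ≡.cong (λ k → ∑< k F) d*n≡2m ⟩
      ∑< (m ℕ.+ m) F                                                         ≈⟨ ∑<-comm (m ℕ.+ m) d (λ a b → g b a) ⟩
      ∑< d (λ b → ∑< (m ℕ.+ m) (g b))                                        ≈⟨ ∑<-cong-< d (λ b<d → correlation i<2m (blocks b<d)) ⟩
      ∑< d (λ b → P * (ε ^ (i ℕ.+ (b ℕ.* n ℕ.+ i′)) * ε + P * δ i (b ℕ.* n ℕ.+ i′)))
                                                                             ≈⟨ *-distribˡ-sum {d} P _ ⟨
      P * ∑< d (λ b → ε ^ (i ℕ.+ (b ℕ.* n ℕ.+ i′)) * ε + P * δ i (b ℕ.* n ℕ.+ i′))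
                                                                             ≈⟨ *-congˡ (∑-distrib-+ {d} _ _) ⟩
      P * (∑< d (λ b → ε ^ (i ℕ.+ (b ℕ.* n ℕ.+ i′)) * ε) + ∑< d (λ b → P * δ i (b ℕ.* n ℕ.+ i′)))
                                                                             ≈⟨ *-congˡ (+-cong signs (trans (sym (*-distribˡ-sum {d} P _)) (*-congˡ (∑δ d)))) ⟩
      P * (0# + P * δ i i′)                                                  ≈⟨ *-congˡ (+-identityˡ _) ⟩
      P * (P * δ i i′)                                                       ∎
      where
      g : ℕ → ℕ → Carrier
      g b a = w (a ℕ.+ i) * w (a ℕ.+ (m ℕ.+ (b ℕ.* n ℕ.+ i′)))

      F : ℕ → Carrier
      F a = ∑< d (λ b → g b a)

      -- Applying σ^m to the second factor makes the two exponents of ζ in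
      -- correlation cancel exactly on the diagonal.
      expand : ∀ k → (σ ^∘ (i ℕ.+ k)) x * (σ ^∘ (i′ ℕ.+ k)) x ≈ ∑< d (λ j → F (j ℕ.* n ℕ.+ k))
      expand k = begin
        (σ ^∘ (i ℕ.+ k)) x * (σ ^∘ (i′ ℕ.+ k)) x
          ≈⟨ *-cong (σ^x (i ℕ.+ k)) (trans (sym (σ^m-fixes (i′ ℕ.+ k))) (σ^x (m ℕ.+ (i′ ℕ.+ k)))) ⟩
        ∑< d (λ j → w (j ℕ.* n ℕ.+ (i ℕ.+ k))) * S
          ≈⟨ *-distribʳ-sum {d} S _ ⟩
        ∑< d (λ j → w (j ℕ.* n ℕ.+ (i ℕ.+ k)) * S)
          ≈⟨ ∑<-cong d (λ j → trans (*-cong (reflexive (≡.cong w (lem₁ j n i k))) (sym (shift (m ℕ.+ (i′ ℕ.+ k)) j)))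
               (trans (*-distribˡ-sum {d} (w (j ℕ.* n ℕ.+ k ℕ.+ i)) _)
                 (∑<-cong d λ b → *-congˡ (reflexive (≡.cong w (lem₂ j n k b m i′)))))) ⟩
        ∑< d (λ j → F (j ℕ.* n ℕ.+ k))  ∎
        where
        S = ∑< d (λ b → w (b ℕ.* n ℕ.+ (m ℕ.+ (i′ ℕ.+ k))))
        lem₁ : ∀ j n i k → j ℕ.* n ℕ.+ (i ℕ.+ k) ≡ j ℕ.* n ℕ.+ k ℕ.+ i
        lem₁ = solve-∀
        lem₂ : ∀ j n k b m i′ → (b ℕ.+ j) ℕ.* n ℕ.+ (m ℕ.+ (i′ ℕ.+ k)) ≡ j ℕ.* n ℕ.+ k ℕ.+ (m ℕ.+ (b ℕ.* n ℕ.+ i′))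
        lem₂ = solve-∀

      blocks : ∀ {b} → b ℕ.< d → b ℕ.* n ℕ.+ i′ ℕ.< m ℕ.+ m
      blocks {b} b<d = ℕ.<-≤-trans (ℕ.+-monoʳ-< (b ℕ.* n) i′<n)
        (ℕ.≤-trans (ℕ.≤-reflexive (ℕ.+-comm (b ℕ.* n) n)) (ℕ.≤-trans (ℕ.*-monoˡ-≤ n b<d) (ℕ.≤-reflexive d*n≡2m)))

      i<2m : i ℕ.< m ℕ.+ m
      i<2m = ℕ.<-≤-trans i<n (ℕ.≤-trans (ℕ.m≤n*m n d) (ℕ.≤-reflexive d*n≡2m))

      signs : ∑< d (λ b → ε ^ (i ℕ.+ (b ℕ.* n ℕ.+ i′)) * ε) ≈ 0#
      signs = begin
        ∑< d (λ b → ε ^ (i ℕ.+ (b ℕ.* n ℕ.+ i′)) * ε)     ≈⟨ ∑<-cong d (λ b → trans (*-congʳ (trans (^-homo-* ε i (b ℕ.* n ℕ.+ i′)) (*-congˡ (^-homo-* ε (b ℕ.* n) i′))))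
                                                             (solve 4 (λ x y z e → x :* (y :* z) :* e := x :* z :* e :* y) refl
                                                               (ε ^ i) (ε ^ (b ℕ.* n)) (ε ^ i′) ε)) ⟩
        ∑< d (λ b → ε ^ i * ε ^ i′ * ε * ε ^ (b ℕ.* n))   ≈⟨ *-distribˡ-sum {d} (ε ^ i * ε ^ i′ * ε) _ ⟨
        ε ^ i * ε ^ i′ * ε * ∑< d (λ b → ε ^ (b ℕ.* n))   ≈⟨ *-congˡ alternating-d ⟩
        ε ^ i * ε ^ i′ * ε * 0#                           ≈⟨ zeroʳ _ ⟩
        0#                                                ∎

      -- For b > 0 the index b n + i′ is at least n and hence differs from i; only b = 0
      -- contributes.
      ∑δ : ∀ d .{{_ : NonZero d}} → ∑< d (λ b → δ i (b ℕ.* n ℕ.+ i′)) ≈ δ i i′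
      ∑δ (suc d) = trans (+-congˡ (trans (∑<-cong d λ b → δ-≢ (ℕ.<⇒≢ (ℕ.<-≤-trans i<n (ℕ.≤-trans (ℕ.m≤m+n n (b ℕ.* n)) (ℕ.m≤m+n _ i′)))))
        (∑<-0 d))) (+-identityʳ _)
        where
        ∑<-0 : ∀ k → ∑< k (λ _ → 0#) ≈ 0#
        ∑<-0 zero    = refl
        ∑<-0 (suc k) = trans (+-identityˡ _) (∑<-0 k)

-- Order, units and odd roots of 1 in the reals

module RealFacts {c ℓ₁ ℓ₂} (ℝ : RealField c ℓ₁ ℓ₂) where
  open RealField ℝ
  open CommutativeRing commutativeRing using (ring)
  open RingFacts commutativeRing
  open import Algebra.Properties.Ring ring using (-‿distribˡ-*)
  open import Relation.Binary.Reasoning.Setoid setoid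

  <⇒0<- : ∀ {x y} → x < y → 0# < y - x
  <⇒0<- {x} {y} x<y = <-respʳ-≈ (+-comm (- x) y) (<-respˡ-≈ (-‿inverseˡ x) (+-monoʳ-< (- x) x<y))

  *-monoʳ-< : ∀ {t x y} → 0# < t → x < y → t * x < t * y
  *-monoʳ-< {t} {x} {y} 0<t x<y = <-respˡ-≈ (+-identityʳ (t * x)) (<-respʳ-≈ (begin
    t * x + t * (y - x)    ≈⟨ distribˡ t x (y - x) ⟨
    t * (x + (y - x))      ≈⟨ *-congˡ (y+[x-y]≈x y x) ⟩
    t * y                  ∎) (+-monoʳ-< (t * x) (*-pos 0<t (<⇒0<- x<y))))

  ^-pos : ∀ {t} k → 0# < t → 0# < t ^ k
  ^-pos zero    0<t = 0<1
  ^-pos (suc k) 0<t = *-pos 0<t (^-pos k 0<t)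

  <1⇒^<1 : ∀ {t} k → 0# < t → t < 1# → t ^ suc k < 1#
  <1⇒^<1 {t} zero    0<t t<1 = <-respˡ-≈ (sym (*-identityʳ t)) t<1
  <1⇒^<1 {t} (suc k) 0<t t<1 =
    <-trans (*-monoʳ-< 0<t (<1⇒^<1 k 0<t t<1)) (<-respˡ-≈ (sym (*-identityʳ t)) t<1)

  1<⇒1<^ : ∀ {t} k → 0# < t → 1# < t → 1# < t ^ suc k
  1<⇒1<^ {t} zero    0<t 1<t = <-respʳ-≈ (sym (*-identityʳ t)) 1<t
  1<⇒1<^ {t} (suc k) 0<t 1<t =
    <-trans (<-respʳ-≈ (sym (*-identityʳ t)) 1<t) (*-monoʳ-< 0<t (1<⇒1<^ k 0<t 1<t))

  #⇒unit : ∀ {x y} → x # y → Unit (x - y)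
  #⇒unit x#y = let u , ul , _ = #⇒invertible x#y in u , ul

  unit⇒#0 : ∀ {x} → Unit x → x # 0#
  unit⇒#0 {x} U = let u , e = unit-resp (sym (x-0≈x x)) U in
    invertible⇒# (u , e , trans (*-comm _ _) e)
    where
    x-0≈x : ∀ x → x - 0# ≈ x
    x-0≈x x = trans (+-congˡ -0#≈0#) (+-identityʳ x)

  -- As a unit, t is apart from 0. If t were negative, - t times the even power t^(2m) would be
  -- positive, yet it equals -1.
  odd-root-pos : ∀ m {t} → t ^ suc (m ℕ.+ m) ≈ 1# → 0# < t
  odd-root-pos m {t} t^≈1 with #⇒<⊎> (unit⇒#0 (t ^ (m ℕ.+ m) , trans (*-comm _ _) t^≈1))
  ... | inj₂ 0<t = 0<t
  ... | inj₁ t<0 = contradiction 0<1 λ 0<1 → <-irrefl refl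
    (<-trans 0<1 (<-respʳ-≈ (trans (+-congˡ -1≈) (-‿inverseʳ 1#)) (<-respˡ-≈ (+-identityʳ 1#) (+-monoʳ-< 1# 0<-t^))))
    where
    0<-t : 0# < - t
    0<-t = <-respʳ-≈ (+-identityˡ (- t)) (<⇒0<- t<0)
    -t*-t≈t*t : - t * - t ≈ t * t
    -t*-t≈t*t = begin
      - t * - t             ≈⟨ *-cong (-1*x≈-x t) (-1*x≈-x t) ⟨
      ε * t * (ε * t)       ≈⟨ solve 2 (λ e t → e :* t :* (e :* t) := e :* e :* (t :* t)) refl ε t ⟩
      ε * ε * (t * t)       ≈⟨ trans (*-congʳ ε*ε≈1) (*-identityˡ _) ⟩
      t * t                 ∎
    square : ∀ m → (t * t) ^ m ≈ t ^ (m ℕ.+ m)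
    square zero    = refl
    square (suc m) = trans (*-congˡ (square m)) (trans (*-assoc t t _)
      (*-congˡ (reflexive (≡.cong (t ^_) (≡.sym (ℕ.+-suc m m))))))
    0<-t^ : 0# < - t * t ^ (m ℕ.+ m)
    0<-t^ = *-pos 0<-t (<-respʳ-≈ (square m) (^-pos m (<-respʳ-≈ -t*-t≈t*t (*-pos 0<-t 0<-t))))
    -1≈ : - t * t ^ (m ℕ.+ m) ≈ - 1#
    -1≈ = trans (sym (-‿distribˡ-* t _)) (-‿cong t^≈1)

  -- Tightness reduces equality to refuting apartness; powers of a positive t stay on the same side
  -- of 1 as t.
  odd-root≈1 : ∀ m {t} → t ^ suc (m ℕ.+ m) ≈ 1# → t ≈ 1#
  odd-root≈1 m {t} t^≈1 = proj₁ (tight t 1#) λ t#1 →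
    [ (λ t<1 → <-irrefl t^≈1 (<1⇒^<1 (m ℕ.+ m) 0<t t<1))
    , (λ 1<t → <-irrefl (sym t^≈1) (1<⇒1<^ (m ℕ.+ m) 0<t 1<t)) ]′ (#⇒<⊎> t#1)
    where 0<t = odd-root-pos m t^≈1

  1/ℕ-inverse : ∀ k .{{_ : NonZero k}} → 1/ℕ k * fromℕ k ≈ 1#
  1/ℕ-inverse (suc k) = trans (*-congˡ (sym (trans (+-congˡ -0#≈0#) (+-identityʳ _))))
    (proj₁ (proj₂ (#⇒invertible (#-sym (<⇒# (fromℕ-pos k))))))

  2-unit : Unit (1# + 1#)
  2-unit = 1/ℕ 2 , trans (*-congˡ (+-congˡ (sym (+-identityʳ 1#)))) (1/ℕ-inverse 2)

-- Complex conjugation and invertibility of 1 - ζ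

module ComplexFacts {c ℓ₁ ℓ₂} (ℝ : RealField c ℓ₁ ℓ₂) where
  private module ℂ = Complex ℝ
  open RealField ℝ
  open CommutativeRing commutativeRing using (ring)
  open RingFacts commutativeRing
  open RealFacts ℝ
  open RingFacts ℂ.commutativeRing using () renaming (Unit to Unitℂ; _^_ to _^ℂ_; unit-cancelˡ to unit-cancelˡℂ)
  open import Algebra.Properties.Ring ring using (-‿distribˡ-*; -‿distribʳ-*)
  open import Algebra.Properties.AbelianGroup (CommutativeRing.+-abelianGroup commutativeRing) using (⁻¹-∙-comm)

  conj : ℂ.Carrier → ℂ.Carrier
  conj (a , b) = a , - b

  conj-cong : ∀ {x y} → x ℂ.≈ y → conj x ℂ.≈ conj y
  conj-cong (e , f) = e , -‿cong f

  -x*-y≈x*y : ∀ x y → - x * - y ≈ x * y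
  -x*-y≈x*y x y = trans (sym (-‿distribˡ-* x (- y))) (trans (-‿cong (sym (-‿distribʳ-* x y))) (-‿involutive (x * y)))

  conj-* : ∀ x y → conj (x ℂ.* y) ℂ.≈ conj x ℂ.* conj y
  conj-* (a , b) (c , d) =
    +-congˡ (-‿cong (sym (-x*-y≈x*y b d))) ,
    trans (sym (⁻¹-∙-comm (a * d) (b * c))) (+-cong (-‿distribʳ-* a d) (-‿distribˡ-* b c))

  conj-+ : ∀ x y → conj (x ℂ.+ y) ℂ.≈ conj x ℂ.+ conj y
  conj-+ (a , b) (c , d) = refl , sym (⁻¹-∙-comm b d)

  conj-1 : conj ℂ.1# ℂ.≈ ℂ.1#
  conj-1 = refl , -0#≈0#

  conj-^ : ∀ x k → conj (x ^ℂ k) ℂ.≈ conj x ^ℂ k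
  conj-^ x zero    = conj-1
  conj-^ x (suc k) = ℂ.trans (conj-* x (x ^ℂ k)) (ℂ.*-congˡ {conj x} (conj-^ x k))

  ∣_∣² : ℂ.Carrier → Carrier
  ∣ a , b ∣² = a * a + b * b

  x*conj : ∀ x → x ℂ.* conj x ℂ.≈ ℂ.fromℝ ∣ x ∣²
  x*conj (a , b) =
    +-congˡ (trans (-‿cong (sym (-‿distribʳ-* b b))) (-‿involutive (b * b))) ,
    trans (+-cong (sym (-‿distribʳ-* a b)) (*-comm b a)) (-‿inverseˡ (a * b))

  fromℝ-* : ∀ a b → ℂ.fromℝ (a * b) ℂ.≈ ℂ.fromℝ a ℂ.* ℂ.fromℝ b
  fromℝ-* a b =
    sym (trans (+-congˡ (trans (-‿cong (zeroˡ 0#)) -0#≈0#)) (+-identityʳ (a * b))) ,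
    sym (trans (+-cong (zeroʳ a) (zeroˡ b)) (+-identityʳ 0#))

  fromℝ-^ : ∀ a k → ℂ.fromℝ (a ^ k) ℂ.≈ ℂ.fromℝ a ^ℂ k
  fromℝ-^ a zero    = ℂ.refl
  fromℝ-^ a (suc k) = ℂ.trans (fromℝ-* a (a ^ k)) (ℂ.*-congˡ {ℂ.fromℝ a} (fromℝ-^ a k))

  module _ (m : ℕ) (ζ : ℂ.Carrier) (root : ℂ.IsNontrivialRootOfUnity (suc (m ℕ.+ m)) ζ) where
    open import Algebra.Properties.CommutativeSemiring.Exp ℂ.commutativeSemiring using (^-distrib-*)
    open import Relation.Binary.Reasoning.Setoid ℂ.setoid

    private
      p = suc (m ℕ.+ m)
      a = proj₁ ζ
      b = proj₂ ζ

    -- The p-th power of the real number |ζ|² is ζ^p times its conjugate, hence 1, and p is odd.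
    ∣ζ∣²≈1 : ∣ ζ ∣² ≈ 1#
    ∣ζ∣²≈1 = odd-root≈1 m (proj₁ (begin
      ℂ.fromℝ (∣ ζ ∣² ^ p)          ≈⟨ fromℝ-^ ∣ ζ ∣² p ⟩
      ℂ.fromℝ ∣ ζ ∣² ^ℂ p           ≈⟨ ^-congˡℂ p (x*conj ζ) ⟨
      (ζ ℂ.* conj ζ) ^ℂ p           ≈⟨ ^-distrib-* ζ (conj ζ) p ⟩
      ζ ^ℂ p ℂ.* conj ζ ^ℂ p        ≈⟨ ℂ.*-congˡ {ζ ^ℂ p} (conj-^ ζ p) ⟨
      ζ ^ℂ p ℂ.* conj (ζ ^ℂ p)      ≈⟨ ℂ.*-cong {ζ ^ℂ p} {ℂ.1#} {conj (ζ ^ℂ p)} {ℂ.1#} (proj₁ root) (ℂ.trans (conj-cong (proj₁ root)) conj-1) ⟩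
      ℂ.1# ℂ.* ℂ.1#                 ≈⟨ ℂ.*-identityˡ ℂ.1# ⟩
      ℂ.1#                          ∎))
      where open RingFacts ℂ.commutativeRing using () renaming (^-congˡ to ^-congˡℂ)

    ζ*conj≈1 : ζ ℂ.* conj ζ ℂ.≈ ℂ.1#
    ζ*conj≈1 = ℂ.trans (x*conj ζ) (∣ζ∣²≈1 , refl)

    -- Apartness of ζ from 1 may come from either coordinate. If it is b that is apart from 0, then
    -- (1 + a)(1 - a) = b² gives the inverse (1 + a) / b².
    1-a-unit : Unit (1# - a)
    1-a-unit with proj₂ root
    ... | inj₁ a#1 = #⇒unit (#-sym a#1)
    ... | inj₂ b#0 =
      let v , e = #⇒unit b#0
          v*b≈1 = trans (*-congˡ (sym (trans (+-congˡ -0#≈0#) (+-identityʳ b)))) e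
      in v * v * (1# + a) , ≈1 v v*b≈1
      where
      ≈1 : ∀ v → v * b ≈ 1# → v * v * (1# + a) * (1# - a) ≈ 1#
      ≈1 v v*b≈1 = trans (*-congˡ (x-y≈x+εy 1# a)) (trans
        (solve 3 (λ v a e → v :* v :* (con 1 :+ a) :* (con 1 :+ e :* a) :=
          v :* v :* (con 1 :+ (con 1 :+ e) :* a :+ e :* (a :* a))) refl v a ε)
        (trans (*-congˡ (trans (+-congʳ (trans (+-congˡ (trans (*-congʳ (trans (+-comm 1# ε) ε+1≈0)) (zeroˡ a))) (+-identityʳ 1#)))
          (trans (+-congʳ (sym ∣ζ∣²≈1)) (trans
            (solve 3 (λ a b e → a :* a :+ b :* b :+ e :* (a :* a) := b :* b :+ (e :+ con 1) :* (a :* a)) refl a b ε)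
            (trans (+-congˡ (trans (*-congʳ ε+1≈0) (zeroˡ _))) (+-identityʳ _))))))
        (trans (solve 2 (λ v b → v :* v :* (b :* b) := v :* b :* (v :* b)) refl v b)
          (trans (*-cong v*b≈1 v*b≈1) (*-identityˡ 1#)))))

    -- Expand to 1 - 2a + |ζ|² and use |ζ|² = 1. The result is a product of units, so conj y / |y|²
    -- inverts y = 1 - ζ.
    ∣1-ζ∣² : ∣ ℂ.1# ℂ.- ζ ∣² ≈ (1# + 1#) * (1# - a)
    ∣1-ζ∣² = trans (+-cong (*-cong (x-y≈x+εy 1# a) (x-y≈x+εy 1# a)) (*-cong 0-b 0-b)) (trans
      (solve 3 (λ a b e → (con 1 :+ e :* a) :* (con 1 :+ e :* a) :+ e :* b :* (e :* b) :=
        con 1 :+ (e :* a :+ e :* a) :+ e :* e :* (a :* a :+ b :* b)) refl a b ε)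
      (trans (+-congˡ (trans (*-cong ε*ε≈1 ∣ζ∣²≈1) (*-identityˡ 1#))) (trans
      (solve 2 (λ a e → con 1 :+ (e :* a :+ e :* a) :+ con 1 := (con 1 :+ con 1) :* (con 1 :+ e :* a)) refl a ε)
      (*-congˡ (sym (x-y≈x+εy 1# a))))))
      where
      0-b : 0# - b ≈ ε * b
      0-b = trans (+-identityˡ (- b)) (sym (-1*x≈-x b))

    1-ζ-unitℂ : Unitℂ (ℂ.1# ℂ.- ζ)
    1-ζ-unitℂ =
      let u , e = unit-resp (sym ∣1-ζ∣²) (unit-* 2-unit 1-a-unit)
          y = ℂ.1# ℂ.- ζ
      in ℂ.fromℝ u ℂ.* conj y , (begin
        ℂ.fromℝ u ℂ.* conj y ℂ.* y          ≈⟨ ℂ.*-assoc (ℂ.fromℝ u) (conj y) y ⟩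
        ℂ.fromℝ u ℂ.* (conj y ℂ.* y)        ≈⟨ ℂ.*-congˡ {ℂ.fromℝ u} (ℂ.trans (ℂ.*-comm (conj y) y) (x*conj y)) ⟩
        ℂ.fromℝ u ℂ.* ℂ.fromℝ ∣ y ∣²        ≈⟨ fromℝ-* u ∣ y ∣² ⟨
        ℂ.fromℝ (u * ∣ y ∣²)                ≈⟨ e , refl ⟩
        ℂ.1#                                ∎)

  conj-fixed⇒real : ∀ y → conj y ℂ.≈ y → proj₂ y ≈ 0#
  conj-fixed⇒real (a , b) (_ , -b≈b) = unit-cancel-0 2-unit (trans
    (solve 1 (λ b → (con 1 :+ con 1) :* b := b :+ b) refl b) (trans (+-congʳ (sym -b≈b)) (-‿inverseˡ b)))

  module _ (ζ : ℂ.Carrier) where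
    private module ℚζ = Adjoin ℝ ζ
    open ℚζ using (_∈ℚ⟨ζ⟩; ζ∈; 0∈; 1∈; +∈; *∈; -∈; inv∈; ≈∈; toℂ)
    open RingMorphisms ℚζ.rawRing ℚζ.rawRing using (IsRingHomomorphism)

    -- Two homomorphisms that agree on ζ agree on everything generated by it, by induction on the
    -- derivation of membership.
    hom≈conj : ∀ τ → IsRingHomomorphism τ → toℂ (τ ℚζ.ζ′) ℂ.≈ conj ζ →
               ∀ {y} (y∈ : y ∈ℚ⟨ζ⟩) → toℂ (τ (y , y∈)) ℂ.≈ conj y
    hom≈conj τ τ-hom τζ = go
      where
      open IsRingHomomorphism τ-hom
      go : ∀ {y} (y∈ : y ∈ℚ⟨ζ⟩) → toℂ (τ (y , y∈)) ℂ.≈ conj y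
      go ζ∈ = τζ
      go 0∈ = ℂ.trans 0#-homo (refl , sym -0#≈0#)
      go 1∈ = ℂ.trans 1#-homo (ℂ.sym conj-1)
      go (+∈ {x} {y} x∈ y∈) = ℂ.trans (+-homo (x , x∈) (y , y∈))
        (ℂ.trans (ℂ.+-cong (go x∈) (go y∈)) (ℂ.sym (conj-+ x y)))
      go (*∈ {x} {y} x∈ y∈) = ℂ.trans (*-homo (x , x∈) (y , y∈))
        (ℂ.trans (ℂ.*-cong (go x∈) (go y∈)) (ℂ.sym (conj-* x y)))
      go (-∈ {x} x∈) = ℂ.trans (-‿homo (x , x∈)) (ℂ.-‿cong (go x∈))
      -- The induction hypothesis concerns x alone; τ(y) and the conjugate of y are compared as
      -- inverses of the conjugate of x.
      go {y} y∈@(inv∈ {x} x∈ xy≈1) = unit-cancelˡℂ {conj x} (conj y , ℂ.trans (ℂ.*-comm (conj y) (conj x)) conj-xy) (begin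
        conj x ℂ.* toℂ (τ (y , y∈))              ≈⟨ ℂ.*-congʳ {toℂ (τ (y , y∈))} (go x∈) ⟨
        toℂ (τ (x , x∈)) ℂ.* toℂ (τ (y , y∈))    ≈⟨ *-homo (x , x∈) (y , y∈) ⟨
        toℂ (τ ((x , x∈) ℚζ.* (y , y∈)))         ≈⟨ ⟦⟧-cong xy≈1 ⟩
        toℂ (τ ℚζ.1#)                            ≈⟨ 1#-homo ⟩
        ℂ.1#                                     ≈⟨ conj-xy ⟨
        conj x ℂ.* conj y                        ∎)
        where
        open import Relation.Binary.Reasoning.Setoid ℂ.setoid
        conj-xy : conj x ℂ.* conj y ℂ.≈ ℂ.1#
        conj-xy = ℂ.trans (ℂ.sym (conj-* x y)) (ℂ.trans (conj-cong xy≈1) conj-1)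
      go (≈∈ {x} {y} x∈ x≈y) = ℂ.trans (⟦⟧-cong (ℂ.sym x≈y)) (ℂ.trans (go x∈) (conj-cong x≈y))

-- The real matrix and its orthogonality

module OrthogonalMatrix {c ℓ₁ ℓ₂} (ℝ : RealField c ℓ₁ ℓ₂) (n : ℕ) .{{_ : NonZero n}}
  (p : ℕ) .{{p≢0 : NonZero p}} (p-prime : Prime p)
  (ζ : Complex.Carrier ℝ) (root : Complex.IsNontrivialRootOfUnity ℝ p ζ)
  (r : ℤ) (prim : IsPrimitiveRoot r p)
  (σ : Adjoin.Carrier ℝ ζ → Adjoin.Carrier ℝ ζ) (σ-auto : Adjoin.IsAutomorphism ℝ ζ σ)
  (σζ≈ζ^r : Adjoin._≈_ ℝ ζ (σ (Adjoin.ζ′ ℝ ζ)) (Elements.ζ^_ ℝ ζ p r))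
  (l : ℤ) (l-inverse : l ℤ.* (r ℤ.- + 1) ≡ + 1 [mod p ])
  (m : ℕ) .{{_ : NonZero m}} (p≡1+2m : p ≡ suc (m ℕ.+ m))
  .{{_ : NonZero ((p ∸ 1) / n)}}
  (q h : ℕ) (n≡1+2q : n ≡ suc (q ℕ.+ q)) (d≡2h : (p ∸ 1) / n ≡ h ℕ.+ h)
  (d*n≡2m : (p ∸ 1) / n ℕ.* n ≡ m ℕ.+ m) (h*n≡m : h ℕ.* n ≡ m)
  where

  private
    d = (p ∸ 1) / n
    module ℝ = RealField ℝ
    module ℂ = Complex ℝ
    module ℚζ = Adjoin ℝ ζ
    module El = Elements ℝ ζ p
    module T = El.Trace σ n

  open ℚζ using (toℂ; ζ′)
  open RingFacts ℚζ.commutativeRing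
  open RingMorphisms.IsRingIsomorphism σ-auto using () renaming (isRingHomomorphism to σ-hom)
  open RootRepresentative p p-prime r prim
  open IntegerResidues p using (rep)
  open RealFacts ℝ using (1/ℕ-inverse)
  open ComplexFacts ℝ using (conj; ζ*conj≈1; 1-ζ-unitℂ; hom≈conj; conj-fixed⇒real)
  open RangeSum (CommutativeRing.*-commutativeMonoid ℚζ.commutativeRing) using () renaming (∑< to ∏<; ∑<-cong to ∏<-cong)
  open RangeSum (CommutativeRing.+-commutativeMonoid ℚζ.commutativeRing) using (∑<; ∑<-cong)

  root′ : ℂ.IsNontrivialRootOfUnity (suc (m ℕ.+ m)) ζ
  root′ = ≡.subst (λ k → ℂ.IsNontrivialRootOfUnity k ζ) p≡1+2m root

  toℂ-ζ^ : ∀ k → toℂ (ζ′ ^ k) ℂ.≈ ζ ℂ.^ k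
  toℂ-ζ^ zero    = ℂ.refl
  toℂ-ζ^ (suc k) = ℂ.*-congˡ {ζ} (toℂ-ζ^ k)

  1-ζ-unit : Unit (ℚζ.1# ℚζ.- ζ′)
  1-ζ-unit =
    let u , e = 1-ζ-unitℂ m ζ root′
    in (u , ℚζ.inv∈ (proj₂ (ℚζ.1# ℚζ.- ζ′)) (ℂ.trans (ℂ.*-comm _ u) e)) , e

  ζ^≈ : ∀ a → El.ζ^ a ℚζ.≈ ζ′ ^ rep a
  ζ^≈ (+ k)    = ℂ.refl
  ζ^≈ -[1+ k ] = ^-assocʳ ζ′ (p ∸ 1) (suc k)

  cyclotomic : CyclotomicEndomorphism ℚζ.commutativeRing p ρ
  cyclotomic = record
    { ζ        = ζ′
    ; ζ^p≈1    = ℂ.trans (toℂ-ζ^ p) (proj₁ root)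
    ; 1-ζ-unit = 1-ζ-unit
    ; σ        = σ
    ; σ-hom    = σ-hom
    ; σζ≈ζ^ρ   = ℂ.trans σζ≈ζ^r (ζ^≈ r)
    }

  module G = GaussianPeriod ℚζ.commutativeRing m p p≡1+2m p-prime ρ p∤ρ log cyclotomic (rep l) (rep-l l l-inverse)
  module GT = G.Trace n d h q n≡1+2q d≡2h d*n≡2m h*n≡m
  open Iterates ℚζ.commutativeRing σ σ-hom using (iterate-isHom; iterate-cong)

  α≈ : El.α r ℚζ.≈ G.α
  α≈ = ℂ.trans (∏<-cong (suc ((p ∸ 3) / 2)) {λ j → ℚζ.1# ℚζ.- El.ζ^ (r ℤ.^ j)} {λ j → ℚζ.1# ℚζ.- G.conjugate j}
      λ j → ℂ.+-congˡ {ℂ.1#} (ℂ.-‿cong (ℂ.trans (ζ^≈ (r ℤ.^ j)) (G.ζ^-cong {rep (r ℤ.^ j)} {ρ ℕ.^ j} (rep-^ j)))))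
    (ℚζ.reflexive (≡.cong (λ k → ∏< k (λ j → ℚζ.1# ℚζ.- G.conjugate j)) (length m p≡1+2m)))
    where
    -- For m = 1 + m′ the prime is 3 + 2m′, so the truncated subtraction and the division by 2 are
    -- exact.
    length : ∀ m .{{_ : NonZero m}} → p ≡ suc (m ℕ.+ m) → suc ((p ∸ 3) / 2) ≡ m
    length (suc m′) e = ≡.cong suc (≡.trans (≡.cong (λ u → (u ∸ 3) / 2) (≡.trans e (lem m′))) (ℕ.m*n/n≡m m′ 2))
      where
      lem : ∀ m′ → suc (suc m′ ℕ.+ suc m′) ≡ 3 ℕ.+ m′ ℕ.* 2
      lem = solve-∀

  x≈ : T.x r l ℚζ.≈ GT.x
  x≈ = ∑<-cong d {λ j → T.σ^ (suc j ℕ.* n) (El.z r l)} {λ j → T.σ^ (suc j ℕ.* n) G.z} λ j →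
    iterate-cong (suc j ℕ.* n) (ℂ.*-congʳ {toℂ (ℚζ.1# ℚζ.- ζ′)} (ℂ.*-cong (ζ^≈ l) α≈))

  σ^x≈ : ∀ k → T.σ^ k (T.x r l) ℚζ.≈ T.σ^ k GT.x
  σ^x≈ k = iterate-cong k x≈

  x∈𝕂 : T.x r l T.∈𝕂
  x∈𝕂 = ℂ.trans (σ^x≈ n) (ℂ.trans GT.σⁿx≈x (ℂ.sym x≈))

  -- Both sides are inverse to ζ.
  σ^mζ≈conj : toℂ (T.σ^ m ζ′) ℂ.≈ conj ζ
  σ^mζ≈conj = unit-cancelˡℂ (conj ζ , ℂ.trans (ℂ.*-comm (conj ζ) ζ) ζ*conj) (ℂ.trans (ℂ.trans
    (ℂ.*-congˡ {ζ} (ℂ.trans (iterate-cong m (ℂ.sym (ℚζ.*-identityʳ ζ′))) (G.σ^-conjugate m 0))) G.ζζm≈1) (ℂ.sym ζ*conj))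
    where
    open RingFacts ℂ.commutativeRing using () renaming (unit-cancelˡ to unit-cancelˡℂ)
    ζ*conj = ζ*conj≈1 m ζ root′

  φ ψ : ℚζ.Carrier → ℝ.Carrier
  φ y = proj₁ (toℂ y)
  ψ y = proj₂ (toℂ y)

  y : ℕ → ℚζ.Carrier
  y k = T.σ^ k (T.x r l)

  ψy≈0 : ∀ k → ψ (y k) ℝ.≈ ℝ.0#
  ψy≈0 k = conj-fixed⇒real (toℂ (y k)) (ℂ.trans
    (ℂ.sym (hom≈conj ζ (T.σ^ m) (iterate-isHom m) σ^mζ≈conj (proj₂ (y k))))
    (ℂ.trans (iterate-cong m (σ^x≈ k)) (ℂ.trans
      (ℚζ.reflexive (≡.cong (λ f → f GT.x) (≡.sym (Endo.^-homo ℚζ.Carrier σ m k))))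
      (ℂ.trans (GT.σ^m-fixes k) (ℂ.sym (σ^x≈ k))))))

  private
    module R = CommutativeRing ℝ.commutativeRing
    module RF = RingFacts ℝ.commutativeRing
    module RS = RangeSum R.+-commutativeMonoid

  1/p : ℝ.Carrier
  1/p = ℝ.1/ℕ p

  -- Taking real parts yields real entries by construction; by `ψy≈0` no imaginary part is lost.
  G : Matrix ℝ.Carrier n
  G i j = 1/p ℝ.* φ (y (toℕ i ℕ.+ toℕ j))

  G-entries : ∀ i j → ℂ.fromℝ (G i j) ℂ.≈ ℂ.fromℝ 1/p ℂ.* toℂ (T.σ^ (toℕ i ℕ.+ toℕ j) (T.x r l))
  G-entries i j =
    R.sym (R.trans (R.+-congˡ (R.trans (R.-‿cong (R.zeroˡ _)) RF.-0#≈0#)) (R.+-identityʳ _)) ,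
    R.sym (R.trans (R.+-cong (R.trans (R.*-congˡ (ψy≈0 (toℕ i ℕ.+ toℕ j))) (R.zeroʳ _)) (R.zeroˡ _)) (R.+-identityʳ _))

  φ-∑ : ∀ k f → φ (∑< k f) ℝ.≈ RS.∑< k (φ ∘ f)
  φ-∑ zero    f = R.refl
  φ-∑ (suc k) f = R.+-congˡ (φ-∑ k (f ∘ suc))

  φ-* : ∀ a b → ψ a ℝ.≈ ℝ.0# → φ (a ℚζ.* b) ℝ.≈ φ a ℝ.* φ b
  φ-* a b ψa≈0 = R.trans (R.+-congˡ (R.trans (R.-‿cong (R.trans (R.*-congʳ ψa≈0) (R.zeroˡ _))) RF.-0#≈0#)) (R.+-identityʳ _)

  open import Algebra.Definitions.RawSemiring ℚζ.rawSemiring using () renaming (_×_ to _×ℕ_)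

  φ-ℕ : ∀ k → φ (k ×ℕ ℚζ.1#) ℝ.≈ ℝ.fromℕ k
  φ-ℕ zero    = R.refl
  φ-ℕ (suc k) = R.+-congˡ (φ-ℕ k)

  ψ-ℕ : ∀ k → ψ (k ×ℕ ℚζ.1#) ℝ.≈ ℝ.0#
  ψ-ℕ zero    = R.refl
  ψ-ℕ (suc k) = R.trans (R.+-identityˡ _) (ψ-ℕ k)

  open MatrixOps ℝ.rawRing using (IsOrthogonal; 1ᴹ)

  φ-δ : ∀ (i k : Fin n) → φ (G.δ (toℕ i) (toℕ k)) ℝ.≈ 1ᴹ i k
  φ-δ i k with i Fin.≟ k
  ... | yes ≡.refl = proj₁ (G.δ-≡ {toℕ i} ≡.refl)
  ... | no  i≢k    = proj₁ (G.δ-≢ (i≢k ∘ Fin.toℕ-injective))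

  rows-orthonormal : ∀ i k → RS.∑< n (λ j → (1/p ℝ.* φ (y (toℕ i ℕ.+ j))) ℝ.* (1/p ℝ.* φ (y (toℕ k ℕ.+ j)))) ℝ.≈ 1ᴹ i k
  rows-orthonormal i k = begin
    RS.∑< n (λ j → (1/p ℝ.* φ (y (toℕ i ℕ.+ j))) ℝ.* (1/p ℝ.* φ (y (toℕ k ℕ.+ j))))
      ≈⟨ RS.∑<-cong n (λ j → R.trans (RF.solve 3 (λ a u v → a RF.:* u RF.:* (a RF.:* v) RF.:= a RF.:* a RF.:* (u RF.:* v)) R.refl
           1/p (φ (y (toℕ i ℕ.+ j))) (φ (y (toℕ k ℕ.+ j)))) (R.*-congˡ (R.sym (φ-* (y (toℕ i ℕ.+ j)) (y (toℕ k ℕ.+ j)) (ψy≈0 (toℕ i ℕ.+ j)))))) ⟩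
    RS.∑< n (λ j → 1/p ℝ.* 1/p ℝ.* φ (y (toℕ i ℕ.+ j) ℚζ.* y (toℕ k ℕ.+ j)))
      ≈⟨ *-distribˡ-sum {n} (1/p ℝ.* 1/p) _ ⟨
    1/p ℝ.* 1/p ℝ.* RS.∑< n (λ j → φ (y (toℕ i ℕ.+ j) ℚζ.* y (toℕ k ℕ.+ j)))
      ≈⟨ R.*-congˡ (R.trans (R.sym (φ-∑ n (λ j → y (toℕ i ℕ.+ j) ℚζ.* y (toℕ k ℕ.+ j)))) (proj₁ product)) ⟩
    1/p ℝ.* 1/p ℝ.* φ (G.P ℚζ.* (G.P ℚζ.* δ))
      ≈⟨ R.*-congˡ (R.trans (φ-* G.P (G.P ℚζ.* δ) (ψ-ℕ p)) (R.*-cong (φ-ℕ p) (R.trans (φ-* G.P δ (ψ-ℕ p)) (R.*-cong (φ-ℕ p) (φ-δ i k))))) ⟩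
    1/p ℝ.* 1/p ℝ.* (ℝ.fromℕ p ℝ.* (ℝ.fromℕ p ℝ.* 1ᴹ i k))
      ≈⟨ RF.solve 3 (λ a b e → a RF.:* a RF.:* (b RF.:* (b RF.:* e)) RF.:= a RF.:* b RF.:* (a RF.:* b) RF.:* e) R.refl 1/p (ℝ.fromℕ p) (1ᴹ i k) ⟩
    1/p ℝ.* ℝ.fromℕ p ℝ.* (1/p ℝ.* ℝ.fromℕ p) ℝ.* 1ᴹ i k
      ≈⟨ R.*-congʳ (R.trans (R.*-cong (1/ℕ-inverse p) (1/ℕ-inverse p)) (R.*-identityˡ ℝ.1#)) ⟩
    ℝ.1# ℝ.* 1ᴹ i k
      ≈⟨ R.*-identityˡ _ ⟩
    1ᴹ i k ∎
    where
    open import Relation.Binary.Reasoning.Setoid R.setoid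
    open import Algebra.Properties.Semiring.Sum R.semiring using (*-distribˡ-sum)
    δ = G.δ (toℕ i) (toℕ k)
    product : ∑< n (λ j → y (toℕ i ℕ.+ j) ℚζ.* y (toℕ k ℕ.+ j)) ℚζ.≈ G.P ℚζ.* (G.P ℚζ.* δ)
    product = ℂ.trans
      (∑<-cong n {λ j → y (toℕ i ℕ.+ j) ℚζ.* y (toℕ k ℕ.+ j)} {λ j → T.σ^ (toℕ i ℕ.+ j) GT.x ℚζ.* T.σ^ (toℕ k ℕ.+ j) GT.x}
        (λ j → ℂ.*-cong (σ^x≈ (toℕ i ℕ.+ j)) (σ^x≈ (toℕ k ℕ.+ j))))
      (GT.orthogonality (Fin.toℕ<n i) (Fin.toℕ<n k))

  -- The entries depend only on i + j, so G is symmetric and the row relations are also the column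
  -- relations.
  G-orthogonal : IsOrthogonal G
  G-orthogonal = rows-orthonormal , λ i k → R.trans
    (sum-cong {n} {λ j → G j i ℝ.* G j k} {λ j → G i j ℝ.* G k j} (λ j → R.*-cong (G-sym j i) (G-sym j k)))
    (rows-orthonormal i k)
    where
    open import Algebra.Properties.CommutativeMonoid.Sum R.+-commutativeMonoid using () renaming (sum-cong-≋ to sum-cong)
    G-sym : ∀ i j → G i j ℝ.≈ G j i
    G-sym i j = R.reflexive (≡.cong (λ k → 1/p ℝ.* φ (y k)) (ℕ.+-comm (toℕ i) (toℕ j)))

-- Parity of p and of (p - 1)/n

module Parity (n : ℕ) .{{n≢0 : NonZero n}} (1<n : 1 ℕ.< n) (2∤n : ¬ 2 ∣ n)
  (p : ℕ) (p-prime : Prime p) (p≡1 : + p ≡ + 1 [mod n ]) where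

  private instance
    p≢0 : NonZero p
    p≢0 = prime⇒nonZero p-prime

  n∣p-1 : n ∣ p ∸ 1
  n∣p-1 = go p p≡1
    where
    go : ∀ p .{{_ : NonZero p}} → + p ≡ + 1 [mod n ] → n ∣ p ∸ 1
    -- For p = 1 + p′ the integer p - 1 computes to p′, so the congruence is the divisibility
    -- itself.
    go (suc p′) e = e

  2∤p : ¬ 2 ∣ p
  2∤p 2∣p with prime⇒irreducible p-prime 2∣p
  -- If p were 2, n would divide 1, against 1 < n.
  ... | inj₂ 2≡p = ℕ.<⇒≱ 1<n (ℕ.∣⇒≤ (≡.subst (λ u → n ∣ u ∸ 1) (≡.sym 2≡p) n∣p-1))

  m : ℕ
  m = proj₁ (odd-half p 2∤p)

  p≡1+2m : p ≡ suc (m ℕ.+ m)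
  p≡1+2m = proj₂ (odd-half p 2∤p)

  m≢0 : NonZero m
  m≢0 = ℕ.≢-nonZero λ m≡0 → ¬prime[1] (≡.subst Prime (≡.trans p≡1+2m (≡.cong (λ u → suc (u ℕ.+ u)) m≡0)) p-prime)

  d : ℕ
  d = (p ∸ 1) / n

  d*n≡2m : d ℕ.* n ≡ m ℕ.+ m
  d*n≡2m = ≡.trans (ℕ.m/n*n≡m n∣p-1) (≡.cong (_∸ 1) p≡1+2m)

  d≢0 : NonZero d
  d≢0 = ℕ.≢-nonZero λ d≡0 → ℕ.≢-nonZero⁻¹ m {{m≢0}}
    (ℕ.m+n≡0⇒m≡0 m (≡.trans (≡.sym d*n≡2m) (≡.cong (ℕ._* n) d≡0)))

  private
    double : ∀ h → h ℕ.* 2 ≡ h ℕ.+ h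
    double = solve-∀

  -- The product d n = 2m is even and n is odd, so Euclid's lemma leaves only d.
  2∣d : 2 ∣ d
  2∣d with euclidsLemma d n prime[2] (≡.subst (2 ∣_) (≡.sym d*n≡2m) (ℕ.divides m (≡.sym (double m))))
  ... | inj₁ 2∣d = 2∣d
  ... | inj₂ 2∣n = contradiction 2∣n 2∤n

  h : ℕ
  h = _∣_.quotient 2∣d

  d≡2h : d ≡ h ℕ.+ h
  d≡2h = ≡.trans (_∣_.equality 2∣d) (double h)

  h*n≡m : h ℕ.* n ≡ m
  h*n≡m = ℕ.*-cancelʳ-≡ (h ℕ.* n) m 2 (≡.trans (lem h n) (≡.trans (≡.cong (ℕ._* n) (≡.sym (_∣_.equality 2∣d)))
    (≡.trans d*n≡2m (≡.sym (double m)))))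
    where
    lem : ∀ h n → h ℕ.* n ℕ.* 2 ≡ h ℕ.* 2 ℕ.* n
    lem = solve-∀

theorem1 :
    ∀ {c ℓ₁ ℓ₂} (ℝ : RealField c ℓ₁ ℓ₂) →
    let module ℝ = RealField ℝ
        module ℂ = Complex ℝ
        open MatrixOps ℝ.rawRing using (IsOrthogonal)
    in
    (n : ℕ) .{{_ : NonZero n}} → 1 ℕ.< n → ¬ (2 ∣ n) →
    (p : ℕ) (p-prime : Prime p) → (+ p) ≡ (+ 1) [mod n ] →
    (ζ : ℂ.Carrier) → ℂ.IsNontrivialRootOfUnity p ζ →
    let module ℚζ = Adjoin ℝ ζ
        open Elements ℝ ζ p using (ζ^_)
    in
    (r : ℤ) → IsPrimitiveRoot r p →
    (σ : ℚζ.Carrier → ℚζ.Carrier) → ℚζ.IsAutomorphism σ →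
    σ ℚζ.ζ′ ℚζ.≈ ζ^ r →
    (l : ℤ) → l ℤ.* (r ℤ.- + 1) ≡ (+ 1) [mod p ] →
    let open Elements.Trace ℝ ζ p σ n
        1/p = ℝ.1/ℕ p {{prime⇒nonZero p-prime}}
    in
    x r l ∈𝕂 ×
    (Σ[ G ∈ Matrix ℝ.Carrier n ]
      ((∀ i j → ℂ.fromℝ (G i j) ℂ.≈
                ℂ.fromℝ 1/p ℂ.* ℚζ.toℂ (σ^ (toℕ i ℕ.+ toℕ j) (x r l))) ×
       IsOrthogonal G))
theorem1 ℝ n 1<n 2∤n p p-prime p≡1 ζ root r prim σ σ-auto σζ l l-inverse =
  x∈𝕂 , G , G-entries , G-orthogonal
  where
  open Parity n 1<n 2∤n p p-prime p≡1
  n-odd = odd-half n 2∤n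
  open OrthogonalMatrix ℝ n p {{prime⇒nonZero p-prime}} p-prime ζ root r prim σ σ-auto σζ l l-inverse
    m {{m≢0}} p≡1+2m {{d≢0}} (proj₁ n-odd) h (proj₂ n-odd) d≡2h d*n≡2m h*n≡m
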